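{- Let $r\ge 2$, let $a_1,\dots,a_r,b_1,\dots,b_r\in\mathbb C$ with $b_r=1$, and assume that $b_1,\dots,b_r$ are pairwise distinct modulo $\mathbb Z$. Set $$c_i:=\prod_{\substack{1\le j\le r\\ j\ne i}}\frac{1}{b_j-b_i},\qquad i=1,\dots,r.$$ Let $f_i(z)$, $g_i(z)$ ($1\le i\le r$) be the solutions of the hypergeometric equation and of its dual, as defined in the context, let $\theta=z\frac{d}{dz}$, and let $H$ be the field generated over $\mathbb Q$ by the $a_i,b_j$. Then for any $k,l=0,1,\dots,r-1$, $$\sum_{i=1}^r c_i\,\theta^k(f_i)(z)\,\theta^l(g_i)(z)=:M_{kl}\in H(z).$$ In particular, $M_{kl}=0$ if $k+l\le r-2$, and $M_{kl}=\dfrac{(-1)^{k}}{1-z}$ if $k+l=r-1$.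
   Context: $(x)_0:=1$ and $(x)_n:=x(x+1)\cdots(x+n-1)$ for $n\ge1$. The hypergeometric equation of order $r$ is $(\theta+b_1-1)\cdots(\theta+b_r-1)f=z(\theta+a_1)\cdots(\theta+a_r)f$, and its dual is $(\theta-b_1+1)\cdots(\theta-b_r+1)g=z(\theta-a_1+1)\cdots(\theta-a_r+1)g$. For $1\le i\le r$, $$f_i(z):=z^{1-b_i}\sum_{n\ge0}\frac{\prod_{j=1}^r(a_j+1-b_i)_n}{\prod_{j=1}^r(b_j+1-b_i)_n}z^n,\qquad g_i(z):=z^{b_i-1}\sum_{n\ge0}\frac{\prod_{j=1}^r(b_i-a_j)_n}{\prod_{j=1}^r(b_i+1-b_j)_n}z^n$$ (the factor $j=i$ in each denominator equals $n!$). That is, $f_i=z^{1-b_i}\,{}_rF_{r-1}$ with upper parameters $a_j+1-b_i$ ($1\le j\le r$) and lower parameters $b_j+1-b_i$ ($j\ne i$), and $g_i=z^{b_i-1}\,{}_rF_{r-1}$ with upper parameters $b_i-a_j$ ($1\le j\le r$) and lower parameters $b_i+1-b_j$ ($j\neq i$), both evaluated at $z$. The powers $z^s$ are non-trivial solutions of $\theta(f)=sf$ with $z^sz^t=z^{s+t}$, so each product $\theta^k(f_i)\theta^l(g_i)$ is a power series in $z$; membership in $H(z)$ means that the sum is the expansion at $z=0$ of a rational function with coefficients in $H$.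
   Formalization: The value for k+l=r-1 is proved as (-1)^l/(1-z) instead of (-1)^k/(1-z): with the given c_i, f_i, g_i the stated sign fails for every even r (r=2, b_1=1/2, b_2=1, k=0, l=1 has constant term -1); for odd r both signs agree. -}

module Defs where

open import Algebra.Apartness.Bundles using (HeytingCommutativeRing; HeytingField)
open import Algebra.Bundles using (CommutativeRing; Semiring)
import Algebra.Apartness.Properties.HeytingCommutativeRing as HeytingProperties
import Algebra.Definitions.RawSemiring as RawSemiringDefs
import Algebra.Properties.Ring as RingProperties
import Relation.Binary.Reasoning.Setoid as SetoidReasoning
open import Data.Fin.Base using (Fin; toℕ)
open import Data.Fin.Properties using (_≟_)
open import Data.Integer.Base using (ℤ; +_; -[1+_])
open import Data.List.Base using (List; []; _∷_)
open import Data.List.Relation.Unary.All using (All)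
open import Data.List.Relation.Unary.Any using (Any)
open import Data.Nat.Base using (ℕ; zero; suc; _∸_)
open import Data.Product.Base using (∃₂; _×_; _,_; proj₁)
open import Data.Sum.Base using ([_,_]′)
open import Level using (Level; _⊔_)
open import Relation.Binary.PropositionalEquality.Core as ≡ using (_≡_; _≢_)
open import Relation.Nullary.Decidable.Core using (Dec; yes; no)
open import Relation.Unary using (Pred)

-- The base field is a Heyting field: `x # y` is the positive form of x ≠ y,
-- meaning that x - y is invertible.  Classically, this is any field with
-- `x # y` read as ¬ x ≈ y; the complex numbers are an instance.
module Field {c ℓ₁ ℓ₂ : Level} (K : HeytingField c ℓ₁ ℓ₂) where

  open HeytingField K
  open HeytingProperties heytingCommutativeRing
    using (#-congʳ; 1#0; x-0≈x; x#0y#0→xy#0)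
  open CommutativeRing (HeytingCommutativeRing.commutativeRing heytingCommutativeRing)
    using (ring; semiring)
  open RingProperties ring using (-‿involutive)
  open RawSemiringDefs (Semiring.rawSemiring semiring) public
    using (sum; product; _^_) renaming (_×_ to infixr 8 _·_)

  CharZero : Set ℓ₂
  CharZero = ∀ n → suc n · 1# # 0#

  fromℤ : ℤ → Carrier
  fromℤ (+ n)    = n · 1#
  fromℤ -[1+ n ] = - (suc n · 1#)

  -- The library provides an inverse of x - 0#, which equals x.
  inv : ∀ {x} → x # 0# → Carrier
  inv x#0 = proj₁ (#⇒invertible x#0)

  -- The smallest subfield containing all x i; it contains ℚ because it
  -- contains 1# and is closed under the field operations.
  data Adjoin {I : Set} (x : I → Carrier) : Pred Carrier (c ⊔ ℓ₁ ⊔ ℓ₂) where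
    gen  : ∀ i → Adjoin x (x i)
    one  : Adjoin x 1#
    add  : ∀ {y z} → Adjoin x y → Adjoin x z → Adjoin x (y + z)
    neg  : ∀ {y} → Adjoin x y → Adjoin x (- y)
    mul  : ∀ {y z} → Adjoin x y → Adjoin x z → Adjoin x (y * z)
    inve : ∀ {y} (y#0 : y # 0#) → Adjoin x y → Adjoin x (inv y#0)
    resp : ∀ {y z} → y ≈ z → Adjoin x y → Adjoin x z

  ----------------------------------------------------------------------
  -- Power series and rational functions

  PowerSeries : Set c
  PowerSeries = ℕ → Carrier

  infix 4 _≋_
  _≋_ : PowerSeries → PowerSeries → Set ℓ₁
  φ ≋ ψ = ∀ n → φ n ≈ ψ n

  𝟎 : PowerSeries
  𝟎 _ = 0#

  infixl 7 _⊛_ _∙_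
  _⊛_ : PowerSeries → PowerSeries → PowerSeries
  (φ ⊛ ψ) n = sum {suc n} λ m → φ (toℕ m) * ψ (n ∸ toℕ m)

  _∙_ : Carrier → PowerSeries → PowerSeries
  (x ∙ φ) n = x * φ n

  ∑ : ∀ {r} → (Fin r → PowerSeries) → PowerSeries
  ∑ φ n = sum λ i → φ i n

  -- Polynomials are coefficient lists, constant term first.
  Polynomial : Set c
  Polynomial = List Carrier

  ⟦_⟧ : Polynomial → PowerSeries
  ⟦ []    ⟧ _       = 0#
  ⟦ x ∷ P ⟧ zero    = x
  ⟦ x ∷ P ⟧ (suc n) = ⟦ P ⟧ n

  -- φ is the expansion at z = 0 of the rational function P / Q, that is,
  -- Q ≠ 0 and φ = P / Q in the field of Laurent series.
  infix 4 _IsExpansionOf_/_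
  _IsExpansionOf_/_ : PowerSeries → Polynomial → Polynomial → Set (c ⊔ ℓ₁ ⊔ ℓ₂)
  φ IsExpansionOf P / Q = Any (_# 0#) Q × ⟦ Q ⟧ ⊛ φ ≋ ⟦ P ⟧

  infix 4 _∈_⟨z⟩
  _∈_⟨z⟩ : ∀ {ℓ} → PowerSeries → Pred Carrier ℓ → Set (c ⊔ ℓ₁ ⊔ ℓ₂ ⊔ ℓ)
  φ ∈ H ⟨z⟩ = ∃₂ λ P Q → All H P × All H Q × φ IsExpansionOf P / Q

  ----------------------------------------------------------------------
  -- Formal products z^s φ(z) with φ a power series

  record z^_⟦z⟧ (s : Carrier) : Set c where
    constructor z^·
    field series : PowerSeries

  open z^_⟦z⟧ public

  -- θ (z^s z^n) = (s + n) z^s z^n, since θ (z^s) = s z^s.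
  θ : ∀ {s} → z^ s ⟦z⟧ → z^ s ⟦z⟧
  θ {s} F .series n = (s + n · 1#) * F .series n

  θ^ : ∀ {s} → ℕ → z^ s ⟦z⟧ → z^ s ⟦z⟧
  θ^ zero    F = F
  θ^ (suc k) F = θ (θ^ k F)

  -- z^s z^t = z^(s + t)
  infixl 7 _⊗_
  _⊗_ : ∀ {s t} → z^ s ⟦z⟧ → z^ t ⟦z⟧ → z^ (s + t) ⟦z⟧
  F ⊗ G = z^· (F .series ⊛ G .series)

  -- z^0 = 1
  toPowerSeries : ∀ {s} → s ≈ 0# → z^ s ⟦z⟧ → PowerSeries
  toPowerSeries _ F = F .series

  ----------------------------------------------------------------------
  -- Hypergeometric series

  -- (x)_n
  poch : Carrier → ℕ → Carrier
  poch x zero    = 1#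
  poch x (suc n) = poch x n * (x + n · 1#)

  DistinctModℤ : ∀ {r} → (Fin r → Carrier) → Set ℓ₂
  DistinctModℤ b = ∀ i j → i ≢ j → ∀ n → b i - b j # fromℤ n

  x#-y⇒x+y#0 : ∀ {x y} → x # - y → x + y # 0#
  x#-y⇒x+y#0 {x} {y} x#-y with #⇒invertible x#-y
  ... | u , p , q =
    invertible⇒# (u , trans (*-congˡ (sym eq)) p , trans (*-congʳ (sym eq)) q)
    where
    eq : x - (- y) ≈ (x + y) - 0#
    eq = trans (+-congˡ (-‿involutive y)) (sym (x-0≈x (x + y)))

  regroup : ∀ x y m → (x - y) + (1# + m) ≈ (x + 1# - y) + m
  regroup x y m = begin
    (x - y) + (1# + m)   ≈⟨ +-assoc (x - y) 1# m ⟨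
    ((x - y) + 1#) + m   ≈⟨ +-congʳ (+-assoc x (- y) 1#) ⟩
    (x + (- y + 1#)) + m ≈⟨ +-congʳ (+-congˡ (+-comm (- y) 1#)) ⟩
    (x + (1# - y)) + m   ≈⟨ +-congʳ (+-assoc x 1# (- y)) ⟨
    (x + 1# - y) + m     ∎
    where open SetoidReasoning setoid

  poch#0 : ∀ {x} → (∀ m → x + m · 1# # 0#) → ∀ n → poch x n # 0#
  poch#0 x+m#0 zero    = 1#0
  poch#0 x+m#0 (suc n) = x#0y#0→xy#0 (poch#0 x+m#0 n) (x+m#0 n)

  product#0 : ∀ {r} {x : Fin r → Carrier} → (∀ i → x i # 0#) → product x # 0#
  product#0 {zero}  x#0 = 1#0
  product#0 {suc r} x#0 =
    x#0y#0→xy#0 (x#0 Fin.zero) (product#0 λ i → x#0 (Fin.suc i))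

  module Hypergeometric
    (charZero : CharZero) {r : ℕ} (a b : Fin r → Carrier) (distinct : DistinctModℤ b)
    where

    factor#0 : ∀ j i m → (b j + 1# - b i) + m · 1# # 0#
    factor#0 j i m with j ≟ i
    ... | no  j≢i    =
      #-congʳ (regroup _ _ _) (x#-y⇒x+y#0 (distinct j i j≢i -[1+ m ]))
    ... | yes ≡.refl =
      #-congʳ (trans (sym (trans (+-congʳ (-‿inverseʳ (b i))) (+-identityˡ _)))
                     (regroup _ _ _))
              (charZero m)

    denominator#0 : ∀ j i n → poch (b j + 1# - b i) n # 0#
    denominator#0 j i = poch#0 (factor#0 j i)

    exponents-cancel : ∀ i → (1# - b i) + (b i - 1#) ≈ 0#
    exponents-cancel i = begin
      (1# - b i) + (b i - 1#)   ≈⟨ +-assoc 1# (- b i) (b i - 1#) ⟩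
      1# + (- b i + (b i - 1#)) ≈⟨ +-congˡ (+-assoc (- b i) (b i) (- 1#)) ⟨
      1# + ((- b i + b i) - 1#) ≈⟨ +-congˡ (+-congʳ (-‿inverseˡ (b i))) ⟩
      1# + (0# - 1#)            ≈⟨ +-congˡ (+-identityˡ (- 1#)) ⟩
      1# - 1#                   ≈⟨ -‿inverseʳ 1# ⟩
      0#                        ∎
      where open SetoidReasoning setoid

    f : ∀ i → z^ (1# - b i) ⟦z⟧
    f i .series n = product (λ j → poch (a j + 1# - b i) n)
                  * inv (product#0 λ j → denominator#0 j i n)

    g : ∀ i → z^ (b i - 1#) ⟦z⟧
    g i .series n = product (λ j → poch (b i - a j) n)
                  * inv (product#0 λ j → denominator#0 i j n)

    c-factor : ∀ i j → Dec (j ≡ i) → Carrier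
    c-factor i j (yes _)  = 1#
    c-factor i j (no j≢i) = inv (distinct j i j≢i (+ 0))

    -- The product of 1 / (b j - b i) over j ≠ i
    coefficient : Fin r → Carrier
    coefficient i = product λ j → c-factor i j (j ≟ i)

    M : ℕ → ℕ → PowerSeries
    M k l = ∑ λ i →
      coefficient i ∙ toPowerSeries (exponents-cancel i) (θ^ k (f i) ⊗ θ^ l (g i))

    H : Pred Carrier (c ⊔ ℓ₁ ⊔ ℓ₂)
    H = Adjoin [ a , b ]′

{-# OPTIONS --safe #-}
module Submission where

-- Write x_{i,m} = 1 - b_i + m.  The coefficient of z^N in M k l is a sum over
-- the r (N + 1) pairs (i , m) with m ≤ N.  In it, θ^k and θ^l contribute
-- x_{i,m}^k and (N - x_{i,m})^l.  The Pochhammer symbols of the upper parameters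
-- form, up to sign, the value at t = x_{i,m} of Y(t), the product of the rN
-- factors t + a_j - v with 1 ≤ v ≤ N.  Those of the lower parameters, together
-- with c_i, form the inverse of the product of the differences
-- x_{i,m} - x_{j,u} over all other pairs (j , u), up to the same sign
-- (`f*g≈weightOf`, `weight-isWeight`).  So the coefficient is the divided
-- difference of t^k (N - t)^l Y(t) at the r (N + 1) nodes x_{i,m}, which are
-- pairwise apart because the b_i are distinct modulo ℤ.  For a monic polynomial
-- of degree d, the divided difference at n nodes is 0 if d < n - 1 and 1 if
-- d = n - 1 (`dividedDifference`).  With d = k + l + rN and n = r (N + 1) this
-- gives the coefficient 0 if k + l < r - 1 and (-1)^l if k + l = r - 1
-- (`T-low`, `M-low`).
--
-- For rationality, let T k q be the sum of c_i θ^k (f_i) q(θ)(g_i) for a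
-- polynomial q.  The series (1 - z)^(-D) P with P a polynomial over H form a
-- class closed under linear combinations, multiplication by z, and θ
-- (`RationalSeries`).  If q is monic over H, then T 0 q belongs to this class,
-- by induction on deg q.  For deg q < r, the coefficients of T 0 q do not depend
-- on N, by the computation above.  For deg q ≥ r, the dual equation yields monic
-- p⁺ and p⁻ of the degree of q with T 0 p⁺ = z T 0 p⁻ (`T-equation`), and the
-- T 0 of two monic polynomials of the same degree differ by something of lower
-- degree (`T-exchange`), so that (1 - z) T 0 p⁻ is in the class
-- (`T₀-rational`).  Finally, θ (T k q) = T (k + 1) q + T k (s q(s)) extends this
-- to all k by induction (`T-leibniz`, `T-rational`).

open import Defs
open import Algebra.Apartness.Bundles using (HeytingCommutativeRing; HeytingField)
open import Algebra.Bundles using (CommutativeRing; Monoid; RawRing)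
import Algebra.Apartness.Properties.HeytingCommutativeRing as HeytingProperties
import Algebra.Properties.AbelianGroup as AbelianGroupProperties
import Algebra.Properties.CommutativeMonoid.Sum as CommutativeMonoidSum
import Algebra.Properties.CommutativeSemigroup as CommutativeSemigroupProperties
import Algebra.Properties.Monoid.Sum as MonoidSum
import Algebra.Properties.Ring as RingProperties
import Algebra.Properties.Semiring.Mult as SemiringMult
import Algebra.Properties.Semiring.Sum as SemiringSum
import Algebra.Solver.Ring as RingSolver
open import Algebra.Solver.Ring.AlmostCommutativeRing
  using (fromCommutativeRing; _-Raw-AlmostCommutative⟶_; Induced-equivalence)
open import Data.Fin.Base as Fin using (Fin; toℕ)
open import Data.Fin.Properties using (toℕ<n) renaming (_≟_ to _≟ᶠ_)
open import Data.Integer.Base using (+_; -[1+_])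
open import Data.List.Base
  using (List; []; _∷_; _++_; length; map; replicate; applyUpTo; upTo; tabulate; allFin;
         cartesianProduct)
open import Data.List.Membership.Propositional using (_∈_)
open import Data.List.Membership.Propositional.Properties using (∈-upTo⁻; ∈-cartesianProduct⁻)
open import Data.List.Properties
  using (length-++; length-map; length-replicate; length-tabulate; length-upTo)
open import Data.List.Relation.Unary.All as All using (All; []; _∷_)
open import Data.List.Relation.Unary.All.Properties
  using (++⁺; applyUpTo⁺₂; replicate⁺; tabulate⁺)
open import Data.List.Relation.Unary.AllPairs as AllPairs using (AllPairs; _∷_)
open import Data.List.Relation.Unary.Any using (Any; here)
open import Data.List.Relation.Unary.Unique.Propositional.Properties
  using (cartesianProduct⁺; allFin⁺; upTo⁺)
open import Data.Maybe.Base using (just; nothing)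
open import Data.Nat.Base as ℕ using (ℕ; zero; suc; _≤_; _<_; _∸_)
import Data.Nat.Properties as ℕ
open import Data.Product.Base using (∃; ∃₂; _×_; _,_; proj₁; proj₂)
open import Data.Product.Properties using (≡-dec)
open import Data.Sum.Base using ([_,_]′; inj₁; inj₂)
open import Function.Base using (_∘_; id)
open import Level using (0ℓ; _⊔_)
open import Relation.Binary.Definitions using (WeaklyDecidable)
open import Relation.Binary.PropositionalEquality.Core as ≡ using (_≡_; _≢_)
import Relation.Binary.Reasoning.Setoid as SetoidReasoning
open import Relation.Nullary.Decidable.Core using (Dec; yes; no)
open import Relation.Nullary.Negation using (contradiction)

-- Ring identities

-- A ring solver for an arbitrary commutative ring.  Its coefficients are
-- integers, represented by pairs p , n that stand for the difference p - n and
-- have p = 0 or n = 0.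
module IntegerCoefficientSolver {c ℓ} (R : CommutativeRing c ℓ) where
  open CommutativeRing R
  open RingProperties ring
    using (-0#≈0#; ⁻¹-anti-homo-//; x[y-z]≈xy-xz; [y-z]x≈yx-zx)
  open AbelianGroupProperties +-abelianGroup using (⁻¹-∙-comm)
  open CommutativeSemigroupProperties +-commutativeSemigroup using (interchange)
  open SemiringMult semiring using (×-homo-+; ×1-homo-*) renaming (_×_ to _·_)
  open SetoidReasoning setoid

  private
    reduce : ℕ → ℕ → ℕ × ℕ
    reduce (suc p) (suc n) = reduce p n
    reduce p       n       = p , n

    Integer : RawRing 0ℓ 0ℓ
    Integer = record
      { Carrier = ℕ × ℕ
      ; _≈_ = _≡_
      ; _+_ = λ { (p , n) (p′ , n′) → reduce (p ℕ.+ p′) (n ℕ.+ n′) }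
      ; _*_ = λ { (p , n) (p′ , n′) →
                    reduce (p ℕ.* p′ ℕ.+ n ℕ.* n′) (p ℕ.* n′ ℕ.+ n ℕ.* p′) }
      ; -_  = λ { (p , n) → n , p }
      ; 0#  = 0 , 0
      ; 1#  = 1 , 0
      }
    open RawRing Integer using () renaming (_+_ to _+ᶻ_; _*_ to _*ᶻ_; -_ to -ᶻ_)

    difference : ℕ × ℕ → Carrier
    difference (p , n) = p · 1# - n · 1#

    -- 0 and 1 are kept apart so that they denote 0# and 1# on the nose.
    value : ℕ × ℕ → Carrier
    value (0 , 0) = 0#
    value (1 , 0) = 1#
    value z       = difference z

    value≈difference : ∀ z → value z ≈ difference z
    value≈difference (0 , 0)           = sym (-‿inverseʳ 0#)
    value≈difference (1 , 0)           =
      sym (trans (+-congˡ -0#≈0#) (trans (+-identityʳ _) (+-identityʳ 1#)))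
    value≈difference (0 , suc n)       = refl
    value≈difference (1 , suc n)       = refl
    value≈difference (suc (suc p) , n) = refl

    rearrange : ∀ p q u v → (p + q) - (u + v) ≈ (p - v) - (u - q)
    rearrange p q u v = begin
      (p + q) - (u + v)     ≈⟨ +-congˡ (⁻¹-∙-comm u v) ⟨
      (p + q) + (- u - v)   ≈⟨ +-congˡ (+-comm _ _) ⟩
      (p + q) + (- v - u)   ≈⟨ interchange p q (- v) (- u) ⟩
      (p - v) + (q - u)     ≈⟨ +-congˡ (⁻¹-anti-homo-// u q) ⟨
      (p - v) - (u - q)     ∎

    value-reduce : ∀ p n → value (reduce p n) ≈ p · 1# - n · 1#
    value-reduce zero    n       = value≈difference (0 , n)
    value-reduce (suc p) zero    = value≈difference (suc p , 0)
    value-reduce (suc p) (suc n) = begin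
      value (reduce p n)                      ≈⟨ value-reduce p n ⟩
      p · 1# - n · 1#                         ≈⟨ +-identityˡ _ ⟨
      0# + (p · 1# - n · 1#)                  ≈⟨ +-congʳ (-‿inverseʳ 1#) ⟨
      (1# - 1#) + (p · 1# - n · 1#)           ≈⟨ interchange _ _ _ _ ⟩
      (1# + p · 1#) + (- 1# - n · 1#)         ≈⟨ +-congˡ (⁻¹-∙-comm _ _) ⟩
      (1# + p · 1#) - (1# + n · 1#)           ∎

    value-+ : ∀ y z → value (y +ᶻ z) ≈ value y + value z
    value-+ y@(p , n) z@(p′ , n′) = begin
      value (y +ᶻ z)                              ≈⟨ value-reduce (p ℕ.+ p′) (n ℕ.+ n′) ⟩
      (p ℕ.+ p′) · 1# - (n ℕ.+ n′) · 1#
        ≈⟨ +-cong (×-homo-+ 1# p p′) (-‿cong (×-homo-+ 1# n n′)) ⟩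
      (p · 1# + p′ · 1#) - (n · 1# + n′ · 1#)     ≈⟨ +-congˡ (⁻¹-∙-comm _ _) ⟨
      (p · 1# + p′ · 1#) + (- (n · 1#) - n′ · 1#) ≈⟨ interchange _ _ _ _ ⟩
      difference y + difference z
        ≈⟨ +-cong (value≈difference y) (value≈difference z) ⟨
      value y + value z                           ∎

    value-- : ∀ z → value (-ᶻ z) ≈ - value z
    value-- z@(p , n) = begin
      value (-ᶻ z)        ≈⟨ value≈difference (-ᶻ z) ⟩
      n · 1# - p · 1#     ≈⟨ ⁻¹-anti-homo-// _ _ ⟨
      - difference z      ≈⟨ -‿cong (value≈difference z) ⟨
      - value z           ∎

    value-* : ∀ y z → value (y *ᶻ z) ≈ value y * value z
    value-* y@(p , n) z@(p′ , n′) = begin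
      value (y *ᶻ z)
        ≈⟨ value-reduce (p ℕ.* p′ ℕ.+ n ℕ.* n′) (p ℕ.* n′ ℕ.+ n ℕ.* p′) ⟩
      (p ℕ.* p′ ℕ.+ n ℕ.* n′) · 1# - (p ℕ.* n′ ℕ.+ n ℕ.* p′) · 1#
        ≈⟨ +-cong (sum-of-products p p′ n n′) (-‿cong (sum-of-products p n′ n p′)) ⟩
      (P * P′ + N * N′) - (P * N′ + N * P′)   ≈⟨ rearrange _ _ _ _ ⟩
      (P * P′ - N * P′) - (P * N′ - N * N′)
        ≈⟨ +-cong ([y-z]x≈yx-zx _ _ _) (-‿cong ([y-z]x≈yx-zx _ _ _)) ⟨
      (P - N) * P′ - (P - N) * N′             ≈⟨ x[y-z]≈xy-xz _ _ _ ⟨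
      (P - N) * (P′ - N′)
        ≈⟨ *-cong (value≈difference y) (value≈difference z) ⟨
      value y * value z                       ∎
      where
      P = p · 1#
      P′ = p′ · 1#
      N = n · 1#
      N′ = n′ · 1#
      sum-of-products : ∀ s t u v →
        (s ℕ.* t ℕ.+ u ℕ.* v) · 1# ≈ (s · 1#) * (t · 1#) + (u · 1#) * (v · 1#)
      sum-of-products s t u v =
        trans (×-homo-+ 1# (s ℕ.* t) (u ℕ.* v)) (+-cong (×1-homo-* s t) (×1-homo-* u v))

    morphism : Integer -Raw-AlmostCommutative⟶ fromCommutativeRing R
    morphism = record
      { ⟦_⟧ = value
      ; +-homo = value-+
      ; *-homo = value-*
      ; -‿homo = value--
      ; 0-homo = refl
      ; 1-homo = refl
      }

    equal? : WeaklyDecidable (Induced-equivalence morphism)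
    equal? y z with ≡-dec ℕ._≟_ ℕ._≟_ y z
    ... | no  _   = nothing
    ... | yes y≡z = just (reflexive (≡.cong value y≡z))

  open RingSolver Integer (fromCommutativeRing R) morphism equal? public
    using (solve; Polynomial; con; _:+_; _:*_; _:-_; :-_; _:=_)

  :1 : ∀ {n} → Polynomial n
  :1 = con (1 , 0)

  :0 : ∀ {n} → Polynomial n
  :0 = con (0 , 0)

-- Finite sums and products over lists and over Fin n

module FiniteFold {c ℓ} (M : Monoid c ℓ) where
  open Monoid M
  open MonoidSum M using (sum; sum-cong-≋)

  -- The combination of F p over all entries p of a list.
  fold : ∀ {i} {I : Set i} → List I → (I → Carrier) → Carrier
  fold []      F = ε
  fold (p ∷ l) F = F p ∙ fold l F

  module _ {i} {I : Set i} where

    fold-cong : ∀ (l : List I) {F G : I → Carrier} → (∀ p → F p ≈ G p) → fold l F ≈ fold l G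
    fold-cong []      F≈G = refl
    fold-cong (p ∷ l) F≈G = ∙-cong (F≈G p) (fold-cong l F≈G)

    fold-++ : ∀ (l l′ : List I) {F : I → Carrier} → fold (l ++ l′) F ≈ fold l F ∙ fold l′ F
    fold-++ []      l′ = sym (identityˡ _)
    fold-++ (p ∷ l) l′ = trans (∙-congˡ (fold-++ l l′)) (sym (assoc _ _ _))

    fold-map : ∀ {j} {J : Set j} (h : J → I) (l : List J) {F : I → Carrier} →
               fold (map h l) F ≈ fold l (F ∘ h)
    fold-map h []      = refl
    fold-map h (p ∷ l) = ∙-congˡ (fold-map h l)

    fold-tabulate : ∀ {n} (h : Fin n → I) {F : I → Carrier} →
                    fold (tabulate h) F ≈ sum (F ∘ h)
    fold-tabulate {zero}  h = refl
    fold-tabulate {suc n} h = ∙-congˡ (fold-tabulate (h ∘ Fin.suc))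

    fold-applyUpTo : ∀ (h : ℕ → I) n {F : I → Carrier} →
                     fold (applyUpTo h n) F ≈ sum {n} (F ∘ h ∘ toℕ)
    fold-applyUpTo h zero    = refl
    fold-applyUpTo h (suc n) = ∙-congˡ (fold-applyUpTo (h ∘ suc) n)

  fold-cartesianProduct : ∀ {i j} {I : Set i} {J : Set j} (l : List I) (l′ : List J)
    {F : I × J → Carrier} →
    fold (cartesianProduct l l′) F ≈ fold l (λ p → fold l′ (λ q → F (p , q)))
  fold-cartesianProduct []      l′ = refl
  fold-cartesianProduct (p ∷ l) l′ =
    trans (fold-++ (map (p ,_) l′) _)
          (∙-cong (fold-map (p ,_) l′) (fold-cartesianProduct l l′))

  -- The sum over pairs is a double sum.
  fold-grid : ∀ r n (F : Fin r × ℕ → Carrier) →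
    fold (cartesianProduct (allFin r) (upTo n)) F
    ≈ sum {r} (λ i → sum {n} (λ m → F (i , toℕ m)))
  fold-grid r n F =
    trans (fold-cartesianProduct (allFin r) (upTo n))
   (trans (fold-tabulate {n = r} id)
          (sum-cong-≋ {r} (λ i → fold-applyUpTo id n {F = λ m → F (i , m)})))

  sum-split : ∀ (F : ℕ → Carrier) m n →
    sum {m ℕ.+ n} (F ∘ toℕ) ≈ sum {m} (F ∘ toℕ) ∙ sum {n} (λ u → F (m ℕ.+ toℕ u))
  sum-split F zero    n = sym (identityˡ _)
  sum-split F (suc m) n = trans (∙-congˡ (sum-split (F ∘ suc) m n)) (sym (assoc _ _ _))

  sum-splitAt : ∀ (F : ℕ → Carrier) m n →
    sum {suc (m ℕ.+ n)} (F ∘ toℕ)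
    ≈ sum {m} (F ∘ toℕ) ∙ (F m ∙ sum {n} (λ u → F (suc (m ℕ.+ toℕ u))))
  sum-splitAt F zero    n = sym (identityˡ _)
  sum-splitAt F (suc m) n = trans (∙-congˡ (sum-splitAt (F ∘ suc) m n)) (sym (assoc _ _ _))

-- Heyting fields

module FieldTools {c ℓ₁ ℓ₂} (K : HeytingField c ℓ₁ ℓ₂) where
  open HeytingField K hiding (zero)
  open Field K
  open HeytingCommutativeRing heytingCommutativeRing public using (commutativeRing)
  open CommutativeRing commutativeRing public
    using (ring; semiring; +-monoid; *-monoid; *-commutativeMonoid)
  open HeytingProperties heytingCommutativeRing public using (x-0≈x; 1#0; #-congʳ)
  open IntegerCoefficientSolver commutativeRing public hiding (Polynomial)
  open SemiringSum semiring public
    using (sum-cong-≋; ∑-distrib-+; *-distribˡ-sum; sum-replicate-zero)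
  open RingProperties ring public using (-1*x≈-x)
  open SemiringMult semiring public using (×-homo-+)
  open CommutativeMonoidSum *-commutativeMonoid public using ()
    renaming (sum-replicate-zero to product-one; sum-cong-≋ to product-cong; ∑-distrib-+ to product-*)
  open FiniteFold +-monoid public using ()
    renaming (fold to sumOver; fold-cong to sumOver-cong; fold-grid to sumOver-grid)
  open FiniteFold *-monoid public using ()
    renaming ( fold to productOver; fold-cong to productOver-cong; fold-++ to productOver-++
             ; fold-map to productOver-map; fold-grid to productOver-grid
             ; fold-tabulate to productOver-tabulate
             ; sum-split to product-split; sum-splitAt to product-splitAt)
  open SetoidReasoning setoid

  inv-inverseʳ : ∀ {x} (x#0 : x # 0#) → x * inv x#0 ≈ 1#
  inv-inverseʳ {x} x#0 =
    trans (*-congʳ (sym (x-0≈x x))) (proj₂ (proj₂ (#⇒invertible x#0)))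

  *-cancelˡ-# : ∀ {x y z} → x # y → (x - y) * z ≈ 0# → z ≈ 0#
  *-cancelˡ-# {x} {y} {z} x#y xyz≈0 with #⇒invertible x#y
  ... | u , u*≈1 , _ = begin
    z                  ≈⟨ *-identityˡ z ⟨
    1# * z             ≈⟨ *-congʳ u*≈1 ⟨
    u * (x - y) * z    ≈⟨ *-assoc _ _ _ ⟩
    u * ((x - y) * z)  ≈⟨ *-congˡ xyz≈0 ⟩
    u * 0#             ≈⟨ zeroʳ u ⟩
    0#                 ∎

  product-zero : ∀ {n} (F : Fin n → Carrier) i → F i ≈ 0# → product F ≈ 0#
  product-zero F Fin.zero    F≈0 = trans (*-congʳ F≈0) (zeroˡ _)
  product-zero F (Fin.suc i) F≈0 =
    trans (*-congˡ (product-zero (F ∘ Fin.suc) i F≈0)) (zeroʳ _)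

  -- The monic polynomial with the given roots, as a function of t.
  monic : List Carrier → Carrier → Carrier
  monic ρ t = productOver ρ (λ y → t - y)

  monic-cong : ∀ ρ {s t} → s ≈ t → monic ρ s ≈ monic ρ t
  monic-cong ρ s≈t = productOver-cong ρ (λ y → +-congʳ s≈t)

  monic-++ : ∀ ρ ρ′ t → monic (ρ ++ ρ′) t ≈ monic ρ t * monic ρ′ t
  monic-++ ρ ρ′ t = productOver-++ ρ ρ′

  -- 1 for j = 0, and 0 otherwise
  atZero : ℕ → Carrier
  atZero zero    = 1#
  atZero (suc j) = 0#

  -- Lagrange interpolation

  -- Nodes x p are indexed by a type I, with d p q = x p - x q off the diagonal
  -- and d p p = 1; a node set is a list of indices.
  module Lagrange {I : Set} (x : I → Carrier) (d : I → I → Carrier)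
                  (d-diagonal : ∀ p → d p p ≈ 1#) where

    -- Nodes that are apart, and at which d is the difference
    Separated : I → I → Set _
    Separated p q = x p # x q × d p q ≈ x p - x q × d q p ≈ x q - x p

    -- w p is the inverse of the product of x p - x q over all other nodes q.
    IsWeight : List I → (I → Carrier) → Set _
    IsWeight l w = All (λ p → w p * productOver l (d p) ≈ 1#) l

    -- Dropping a node h multiplies the weights of the other nodes by x p - x h.
    removeFirst : ∀ {h l w} → AllPairs Separated (h ∷ l) → IsWeight (h ∷ l) w →
                  IsWeight l (λ p → w p * (x p - x h))
    removeFirst {h} {l} {w} (sep ∷ _) (_ ∷ weight) = All.zipWith step (sep , weight)
      where
      step : ∀ {p} → Separated h p × w p * productOver (h ∷ l) (d p) ≈ 1# →
             w p * (x p - x h) * productOver l (d p) ≈ 1#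
      step ((_ , _ , dph) , eq) =
        trans (*-assoc _ _ _) (trans (*-congˡ (*-congʳ (sym dph))) eq)

    removeSecond : ∀ {h k l w} → AllPairs Separated (h ∷ k ∷ l) → IsWeight (h ∷ k ∷ l) w →
                   IsWeight (h ∷ l) (λ p → w p * (x p - x k))
    removeSecond {h} {k} {l} {w} (((_ , dhk , _) ∷ _) ∷ sep ∷ _) (eqh ∷ _ ∷ weight) =
      head ∷ All.zipWith step (sep , weight)
      where
      pull : ∀ p → d p k ≈ x p - x k → w p * productOver (h ∷ k ∷ l) (d p) ≈ 1# →
             w p * (x p - x k) * productOver (h ∷ l) (d p) ≈ 1#
      pull p dpk eq = trans
        (solve 4 (λ a b c e → a :* b :* (c :* e) := a :* (c :* (b :* e))) refl _ _ _ _)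
        (trans (*-congˡ (*-congˡ (*-congʳ (sym dpk)))) eq)
      head : w h * (x h - x k) * productOver (h ∷ l) (d h) ≈ 1#
      head = pull h dhk eqh
      step : ∀ {p} → Separated k p × w p * productOver (h ∷ k ∷ l) (d p) ≈ 1# →
             w p * (x p - x k) * productOver (h ∷ l) (d p) ≈ 1#
      step ((_ , _ , dpk) , eq) = pull _ dpk eq

    sumOver-shift : ∀ l (w F : I → Carrier) y →
      sumOver l (λ p → w p * (x p - y) * F p)
      ≈ sumOver l (λ p → w p * x p * F p) - y * sumOver l (λ p → w p * F p)
    sumOver-shift []      w F y = solve 1 (λ y → :0 := :0 :- y :* :0) refl y
    sumOver-shift (p ∷ l) w F y = trans (+-congˡ (sumOver-shift l w F y))
      (solve 6 (λ w x y F A B → w :* (x :- y) :* F :+ (A :- y :* B)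
                             := (w :* x :* F :+ A) :- y :* (w :* F :+ B))
             refl _ _ _ _ _ _)

    -- The weights of n nodes sum up to 1 if n = 1 and to 0 otherwise.  For two
    -- nodes h and k, the sum times x h - x k is the difference of the sums that
    -- belong to the node sets without k and without h, which are equal by
    -- induction.
    sum-of-weights : ∀ h l w → AllPairs Separated (h ∷ l) → IsWeight (h ∷ l) w →
                     sumOver (h ∷ l) (λ p → w p * 1#) ≈ atZero (length l)
    sum-of-weights h [] w sep (eq ∷ []) = begin
      w h * 1# + 0#          ≈⟨ +-identityʳ _ ⟩
      w h * 1#               ≈⟨ *-congˡ (trans (*-identityʳ _) (d-diagonal h)) ⟨
      w h * (d h h * 1#)     ≈⟨ eq ⟩
      1#                     ∎
    sum-of-weights h (k ∷ l) w sep@((h#k ∷ sep-h) ∷ (sep-k ∷ sep-l)) weight =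
      *-cancelˡ-# (proj₁ h#k) (begin
        (x h - x k) * (w h * 1# + (w k * 1# + W))
          ≈⟨ solve 6 (λ h k u v W X →
               (h :- k) :* (u :* :1 :+ (v :* :1 :+ W))
               := (u :* (h :- k) :* :1 :+ (X :- k :* W))
                  :- (v :* (k :- h) :* :1 :+ (X :- h :* W)))
               refl (x h) (x k) (w h) (w k) W X ⟩
        (w h * (x h - x k) * 1# + (X - x k * W)) - (w k * (x k - x h) * 1# + (X - x h * W))
          ≈⟨ +-cong (+-congˡ (sumOver-shift l w (λ _ → 1#) (x k)))
                    (-‿cong (+-congˡ (sumOver-shift l w (λ _ → 1#) (x h)))) ⟨
        sumOver (h ∷ l) (λ p → w p * (x p - x k) * 1#)
          - sumOver (k ∷ l) (λ p → w p * (x p - x h) * 1#)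
          ≈⟨ +-cong (sum-of-weights h l _ (sep-h ∷ sep-l) (removeSecond sep weight))
                    (-‿cong (sum-of-weights k l _ (sep-k ∷ sep-l) (removeFirst sep weight))) ⟩
        atZero (length l) - atZero (length l)   ≈⟨ -‿inverseʳ _ ⟩
        0#                                      ∎)
      where
      W = sumOver l (λ p → w p * 1#)
      X = sumOver l (λ p → w p * x p * 1#)

    -- The leading divided difference of a monic polynomial of degree ∣ρ∣ at
    -- more than ∣ρ∣ nodes: 1 if there are ∣ρ∣ + 1 nodes, and 0 otherwise.
    -- A factor t - y is (t - x h) + (x h - y), and t - x h removes the node h.
    dividedDifference : ∀ ρ l w j → AllPairs Separated l → IsWeight l w →
      length l ≡ suc (j ℕ.+ length ρ) →
      sumOver l (λ p → w p * monic ρ (x p)) ≈ atZero j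
    dividedDifference [] (h ∷ l) w j sep weight eq =
      trans (sum-of-weights h l w sep weight)
            (reflexive (≡.cong atZero (≡.trans (ℕ.suc-injective eq) (ℕ.+-identityʳ j))))
    dividedDifference (y ∷ ρ) (h ∷ l) w j sep@(_ ∷ sep-l) weight eq = begin
      w h * ((x h - y) * P h) + sumOver l (λ p → w p * ((x p - y) * P p))
        ≈⟨ +-congˡ (sumOver-cong l λ p → sym (*-assoc _ _ _)) ⟩
      w h * ((x h - y) * P h) + sumOver l (λ p → w p * (x p - y) * P p)
        ≈⟨ +-congˡ (sumOver-shift l w P y) ⟩
      w h * ((x h - y) * P h) + (X - y * W)
        ≈⟨ solve 6 (λ w h y P X W → w :* ((h :- y) :* P) :+ (X :- y :* W)
              := (X :- h :* W) :+ (h :- y) :* (w :* P :+ W)) refl _ _ _ _ _ _ ⟩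
      (X - x h * W) + (x h - y) * sumOver (h ∷ l) (λ p → w p * P p)
        ≈⟨ +-congʳ (sumOver-shift l w P (x h)) ⟨
      sumOver l (λ p → w p * (x p - x h) * P p)
        + (x h - y) * sumOver (h ∷ l) (λ p → w p * P p)
        ≈⟨ +-cong (dividedDifference ρ l _ j sep-l (removeFirst sep weight) |l|)
                  (*-congˡ (dividedDifference ρ (h ∷ l) w (suc j) sep weight (≡.cong suc |l|))) ⟩
      atZero j + (x h - y) * 0#
        ≈⟨ trans (+-congˡ (zeroʳ _)) (+-identityʳ _) ⟩
      atZero j ∎
      where
      P = λ p → monic ρ (x p)
      W = sumOver l (λ p → w p * P p)
      X = sumOver l (λ p → w p * x p * P p)
      |l| : length l ≡ suc (j ℕ.+ length ρ)
      |l| = ≡.trans (ℕ.suc-injective eq) (ℕ.+-suc j (length ρ))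

  -- Power series

  -- Multiplication by z
  shift : PowerSeries → PowerSeries
  shift φ zero    = 0#
  shift φ (suc n) = φ n

  infixl 6 _⊕_
  _⊕_ : PowerSeries → PowerSeries → PowerSeries
  (φ ⊕ ψ) n = φ n + ψ n

  -- Multiplication by 1 - z
  Δ : PowerSeries → PowerSeries
  Δ φ n = φ n - shift φ n

  -- The derivation θ on power series
  ϑ : PowerSeries → PowerSeries
  ϑ φ n = n · 1# * φ n

  shift-cong : ∀ {φ ψ} → φ ≋ ψ → shift φ ≋ shift ψ
  shift-cong φ≋ψ zero    = refl
  shift-cong φ≋ψ (suc n) = φ≋ψ n

  Δ-cong : ∀ {φ ψ} → φ ≋ ψ → Δ φ ≋ Δ ψ
  Δ-cong φ≋ψ n = +-cong (φ≋ψ n) (-‿cong (shift-cong φ≋ψ n))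

  Δ-⊕ : ∀ φ ψ → Δ φ ⊕ Δ ψ ≋ Δ (φ ⊕ ψ)
  Δ-⊕ φ ψ zero    = solve 2 (λ x y → (x :- :0) :+ (y :- :0) := x :+ y :- :0) refl _ _
  Δ-⊕ φ ψ (suc n) =
    solve 4 (λ x x′ y y′ → (x :- x′) :+ (y :- y′) := x :+ y :- (x′ :+ y′)) refl _ _ _ _

  Δ-∙ : ∀ x φ → x ∙ Δ φ ≋ Δ (x ∙ φ)
  Δ-∙ x φ zero    = solve 2 (λ x y → x :* (y :- :0) := x :* y :- :0) refl _ _
  Δ-∙ x φ (suc n) = solve 3 (λ x y y′ → x :* (y :- y′) := x :* y :- x :* y′) refl _ _ _

  Δ-shift : ∀ φ → shift (Δ φ) ≋ Δ (shift φ)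
  Δ-shift φ zero    = sym (-‿inverseʳ 0#)
  Δ-shift φ (suc n) = refl

  -- The commutator of 1 - z and θ is z.
  Δ-ϑ : ∀ φ → ϑ (Δ φ) ⊕ shift φ ≋ Δ (ϑ φ)
  Δ-ϑ φ zero    = solve 1 (λ x → :0 :* (x :- :0) :+ :0 := :0 :* x :- :0) refl _
  Δ-ϑ φ (suc n) = solve 3 (λ n x x′ → (:1 :+ n) :* (x :- x′) :+ x′ := (:1 :+ n) :* x :- n :* x′)
                        refl _ _ _

  ⊛-congʳ : ∀ φ {ψ ψ′} → ψ ≋ ψ′ → φ ⊛ ψ ≋ φ ⊛ ψ′
  ⊛-congʳ φ ψ≋ψ′ n = sum-cong-≋ {suc n} λ m → *-congˡ {φ (toℕ m)} (ψ≋ψ′ (n ∸ toℕ m))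

  ⊛-congˡ : ∀ {φ φ′} ψ → φ ≋ φ′ → φ ⊛ ψ ≋ φ′ ⊛ ψ
  ⊛-congˡ ψ φ≋φ′ n = sum-cong-≋ {suc n} λ m → *-congʳ {ψ (n ∸ toℕ m)} (φ≋φ′ (toℕ m))

  ⊛-zero : ∀ φ ψ → (φ ⊛ ψ) 0 ≈ φ 0 * ψ 0
  ⊛-zero φ ψ = +-identityʳ _

  ⊛-shift : ∀ φ ψ → φ ⊛ shift ψ ≋ shift (φ ⊛ ψ)
  ⊛-shift φ ψ zero          = trans (⊛-zero φ (shift ψ)) (zeroʳ _)
  ⊛-shift φ ψ (suc zero)    = +-congˡ (⊛-shift (φ ∘ suc) ψ zero)
  ⊛-shift φ ψ (suc (suc n)) = +-congˡ (⊛-shift (φ ∘ suc) ψ (suc n))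

  sum-linear : ∀ n (F G : Fin n → Carrier) x →
    sum (λ m → F m + x * G m) ≈ sum F + x * sum G
  sum-linear n F G x =
    trans (∑-distrib-+ F (λ m → x * G m)) (+-congˡ (sym (*-distribˡ-sum x G)))

  ⊛-linearˡ : ∀ φ x φ′ ψ → (φ ⊕ x ∙ φ′) ⊛ ψ ≋ φ ⊛ ψ ⊕ x ∙ (φ′ ⊛ ψ)
  ⊛-linearˡ φ x φ′ ψ n = trans
    (sum-cong-≋ {suc n} λ m →
       solve 4 (λ y x y′ z → (y :+ x :* y′) :* z := y :* z :+ x :* (y′ :* z))
             refl (φ (toℕ m)) x (φ′ (toℕ m)) (ψ (n ∸ toℕ m)))
    (sum-linear (suc n) (λ m → φ (toℕ m) * ψ (n ∸ toℕ m)) (λ m → φ′ (toℕ m) * ψ (n ∸ toℕ m)) x)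

  ⊛-linearʳ : ∀ φ ψ x ψ′ → φ ⊛ (ψ ⊕ x ∙ ψ′) ≋ φ ⊛ ψ ⊕ x ∙ (φ ⊛ ψ′)
  ⊛-linearʳ φ ψ x ψ′ n = trans
    (sum-cong-≋ {suc n} λ m →
       solve 4 (λ y z x z′ → y :* (z :+ x :* z′) := y :* z :+ x :* (y :* z′))
             refl (φ (toℕ m)) (ψ (n ∸ toℕ m)) x (ψ′ (n ∸ toℕ m)))
    (sum-linear (suc n) (λ m → φ (toℕ m) * ψ (n ∸ toℕ m)) (λ m → φ (toℕ m) * ψ′ (n ∸ toℕ m)) x)

  shift-⊛ : ∀ φ ψ → shift φ ⊛ ψ ≋ shift (φ ⊛ ψ)
  shift-⊛ φ ψ zero    = trans (⊛-zero (shift φ) ψ) (zeroˡ _)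
  shift-⊛ φ ψ (suc n) = trans (+-congʳ (zeroˡ _)) (+-identityˡ _)

  Δ-⊛ : ∀ φ ψ → Δ φ ⊛ ψ ≋ Δ (φ ⊛ ψ)
  Δ-⊛ φ ψ n = begin
    (Δ φ ⊛ ψ) n
      ≈⟨ ⊛-congˡ ψ (λ m → +-congˡ {φ m} (sym (-1*x≈-x (shift φ m)))) n ⟩
    ((φ ⊕ (- 1#) ∙ shift φ) ⊛ ψ) n
      ≈⟨ ⊛-linearˡ φ (- 1#) (shift φ) ψ n ⟩
    (φ ⊛ ψ) n + - 1# * (shift φ ⊛ ψ) n
      ≈⟨ +-congˡ (trans (-1*x≈-x _) (-‿cong (shift-⊛ φ ψ n))) ⟩
    Δ (φ ⊛ ψ) n ∎

  ⊛-Δ : ∀ φ ψ → φ ⊛ Δ ψ ≋ Δ (φ ⊛ ψ)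
  ⊛-Δ φ ψ n = begin
    (φ ⊛ Δ ψ) n
      ≈⟨ ⊛-congʳ φ (λ m → +-congˡ {ψ m} (sym (-1*x≈-x (shift ψ m)))) n ⟩
    (φ ⊛ (ψ ⊕ (- 1#) ∙ shift ψ)) n
      ≈⟨ ⊛-linearʳ φ ψ (- 1#) (shift ψ) n ⟩
    (φ ⊛ ψ) n + - 1# * (φ ⊛ shift ψ) n
      ≈⟨ +-congˡ (trans (-1*x≈-x _) (-‿cong (⊛-shift φ ψ n))) ⟩
    Δ (φ ⊛ ψ) n ∎

  ⟦1⟧-⊛ : ∀ φ → ⟦ 1# ∷ [] ⟧ ⊛ φ ≋ φ
  ⟦1⟧-⊛ φ zero    = trans (⊛-zero ⟦ 1# ∷ [] ⟧ φ) (*-identityˡ _)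
  ⟦1⟧-⊛ φ (suc n) = trans (+-cong (*-identityˡ _)
    (trans (sum-cong-≋ {suc n} (λ m → zeroˡ (φ (n ∸ toℕ m)))) (sum-replicate-zero (suc n)))) (+-identityʳ _)

  -- subtractShifted x P is P - z P if x is 0; in general it is P - (x + z P).
  subtractShifted : Carrier → Polynomial → Polynomial
  subtractShifted x []      = - x ∷ []
  subtractShifted x (y ∷ P) = (y - x) ∷ subtractShifted y P

  subtractShifted-suc : ∀ x P n → ⟦ subtractShifted x P ⟧ (suc n) ≈ ⟦ P ⟧ (suc n) - ⟦ P ⟧ n
  subtractShifted-suc x []          n       = sym (-‿inverseʳ 0#)
  subtractShifted-suc x (y ∷ [])    zero    = sym (+-identityˡ _)
  subtractShifted-suc x (y ∷ [])    (suc n) = sym (-‿inverseʳ 0#)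
  subtractShifted-suc x (y ∷ z ∷ P) zero    = refl
  subtractShifted-suc x (y ∷ z ∷ P) (suc n) = subtractShifted-suc y (z ∷ P) n

  ⟦subtractShifted⟧ : ∀ P → ⟦ subtractShifted 0# P ⟧ ≋ Δ ⟦ P ⟧
  ⟦subtractShifted⟧ []      zero    = sym (+-identityˡ _)
  ⟦subtractShifted⟧ (y ∷ P) zero    = refl
  ⟦subtractShifted⟧ P       (suc n) = subtractShifted-suc 0# P n

  -- Rational functions whose denominator is a power of 1 - z

  module RationalSeries {I : Set} (gens : I → Carrier) where

    private
      H = Adjoin gens

    zero∈H : H 0#
    zero∈H = resp (-‿inverseʳ 1#) (add one (neg one))

    ℕ∈H : ∀ n → H (n · 1#)
    ℕ∈H zero    = zero∈H
    ℕ∈H (suc n) = add one (ℕ∈H n)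

    -- The power series (1 - z)^(-D) P with P a polynomial over H
    data Rational : PowerSeries → Set (c ⊔ ℓ₁ ⊔ ℓ₂) where
      polynomial : ∀ {φ} B → (∀ n → H (φ n)) → (∀ n → B ≤ n → φ n ≈ 0#) → Rational φ
      divide     : ∀ {φ} → Rational (Δ φ) → Rational φ

    Rational-resp : ∀ {φ ψ} → φ ≋ ψ → Rational φ → Rational ψ
    Rational-resp φ≋ψ (polynomial B φ∈H φ≈0) =
      polynomial B (λ n → resp (φ≋ψ n) (φ∈H n)) (λ n B≤n → trans (sym (φ≋ψ n)) (φ≈0 n B≤n))
    Rational-resp φ≋ψ (divide R) = divide (Rational-resp (Δ-cong φ≋ψ) R)

    Rational-shift : ∀ {φ} → Rational φ → Rational (shift φ)
    Rational-shift {φ} (polynomial B φ∈H φ≈0) = polynomial (suc B) ∈H ≈0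
      where
      ∈H : ∀ n → H (shift φ n)
      ∈H zero    = zero∈H
      ∈H (suc n) = φ∈H n
      ≈0 : ∀ n → suc B ≤ n → shift φ n ≈ 0#
      ≈0 (suc n) B<n = φ≈0 n (ℕ.≤-pred B<n)
    Rational-shift (divide R) = divide (Rational-resp (Δ-shift _) (Rational-shift R))

    Rational-∙ : ∀ {x φ} → H x → Rational φ → Rational (x ∙ φ)
    Rational-∙ x∈H (polynomial B φ∈H φ≈0) = polynomial B (λ n → mul x∈H (φ∈H n))
      (λ n B≤n → trans (*-congˡ (φ≈0 n B≤n)) (zeroʳ _))
    Rational-∙ {x} x∈H (divide R) = divide (Rational-resp (Δ-∙ x _) (Rational-∙ x∈H R))

    private
      polynomial-⊕ : ∀ {φ ψ} B → (∀ n → H (φ n)) → (∀ n → B ≤ n → φ n ≈ 0#) →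
                     Rational ψ → Rational (φ ⊕ ψ)

    Rational-Δ : ∀ {φ} → Rational φ → Rational (Δ φ)
    polynomial-⊕ {φ} {ψ} B φ∈H φ≈0 (polynomial C ψ∈H ψ≈0) =
      polynomial (B ℕ.+ C) (λ n → add (φ∈H n) (ψ∈H n)) λ n B+C≤n →
        trans (+-cong (φ≈0 n (ℕ.≤-trans (ℕ.m≤m+n B C) B+C≤n))
                      (ψ≈0 n (ℕ.≤-trans (ℕ.m≤n+m C B) B+C≤n)))
              (+-identityʳ 0#)
    polynomial-⊕ {φ} {ψ} B φ∈H φ≈0 (divide R) =
      divide (Rational-resp (Δ-⊕ φ ψ) (polynomial-⊕ (suc B) ∈H ≈0 R))
      where
      ∈H : ∀ n → H (Δ φ n)
      ∈H zero    = add (φ∈H zero) (neg zero∈H)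
      ∈H (suc n) = add (φ∈H (suc n)) (neg (φ∈H n))
      ≈0 : ∀ n → suc B ≤ n → Δ φ n ≈ 0#
      ≈0 (suc n) B<n = trans
        (+-cong (φ≈0 (suc n) (ℕ.<⇒≤ B<n)) (-‿cong (φ≈0 n (ℕ.≤-pred B<n)))) (-‿inverseʳ 0#)

    Rational-Δ R@(polynomial B φ∈H φ≈0) = Rational-resp
      (λ n → +-congˡ (-1*x≈-x _))
      (polynomial-⊕ B φ∈H φ≈0 (Rational-∙ (neg one) (Rational-shift R)))
    Rational-Δ (divide R) = R

    Rational-⊕ : ∀ {φ ψ} → Rational φ → Rational ψ → Rational (φ ⊕ ψ)
    Rational-⊕ (polynomial B φ∈H φ≈0) S = polynomial-⊕ B φ∈H φ≈0 S
    Rational-⊕ (divide R)             S =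
      divide (Rational-resp (Δ-⊕ _ _) (Rational-⊕ R (Rational-Δ S)))

    Rational-ϑ : ∀ {φ} → Rational φ → Rational (ϑ φ)
    Rational-ϑ (polynomial B φ∈H φ≈0) = polynomial B (λ n → mul (ℕ∈H n) (φ∈H n))
      (λ n B≤n → trans (*-congˡ (φ≈0 n B≤n)) (zeroʳ _))
    Rational-ϑ (divide R) = divide
      (Rational-resp (Δ-ϑ _) (Rational-⊕ (Rational-ϑ R) (Rational-shift (divide R))))

    -- The expansion of x / (1 - z)
    Rational-constant : ∀ {x φ} → H x → (∀ n → φ n ≈ x) → Rational φ
    Rational-constant {x} {φ} x∈H φ≈x = divide (polynomial 1 ∈H ≈0)
      where
      ≈0 : ∀ n → 1 ≤ n → Δ φ n ≈ 0#
      ≈0 (suc n) _ = trans (+-cong (φ≈x (suc n)) (-‿cong (φ≈x n))) (-‿inverseʳ x)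
      ∈H : ∀ n → H (Δ φ n)
      ∈H zero    = resp (trans (sym (φ≈x 0)) (sym (x-0≈x _))) x∈H
      ∈H (suc n) = resp (sym (≈0 (suc n) (ℕ.s≤s ℕ.z≤n))) zero∈H

    Rational⇒∈⟨z⟩ : ∀ {φ} → Rational φ → φ ∈ H ⟨z⟩
    Rational⇒∈⟨z⟩ R with expand R
      where
      -- Denominators with constant term 1
      expand : ∀ {φ} → Rational φ → ∃₂ λ P Q → All H P × All H Q × ⟦ Q ⟧ 0 ≈ 1# × ⟦ Q ⟧ ⊛ φ ≋ ⟦ P ⟧
      expand {φ} (polynomial B φ∈H φ≈0) =
        applyUpTo φ B , 1# ∷ [] , applyUpTo⁺₂ φ B φ∈H , one ∷ [] , refl ,
        λ n → trans (⟦1⟧-⊛ φ n) (coefficients φ B φ≈0 n)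
        where
        coefficients : ∀ φ B → (∀ n → B ≤ n → φ n ≈ 0#) → φ ≋ ⟦ applyUpTo φ B ⟧
        coefficients φ zero    φ≈0 n       = φ≈0 n ℕ.z≤n
        coefficients φ (suc B) φ≈0 zero    = refl
        coefficients φ (suc B) φ≈0 (suc n) =
          coefficients (φ ∘ suc) B (λ n B≤n → φ≈0 (suc n) (ℕ.s≤s B≤n)) n
      expand {φ} (divide R) with expand R
      ... | P , Q , P∈H , Q∈H , Q0≈1 , QΔφ≋P =
        P , subtractShifted 0# Q , P∈H , ∈H zero∈H Q∈H ,
        trans (⟦subtractShifted⟧ Q 0) (trans (x-0≈x _) Q0≈1) ,
        λ n → trans (⊛-congˡ φ (⟦subtractShifted⟧ Q) n)
             (trans (Δ-⊛ ⟦ Q ⟧ φ n) (trans (sym (⊛-Δ ⟦ Q ⟧ φ n)) (QΔφ≋P n)))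
        where
        ∈H : ∀ {x P} → H x → All H P → All H (subtractShifted x P)
        ∈H x∈H []          = neg x∈H ∷ []
        ∈H x∈H (y∈H ∷ P∈H) = add y∈H (neg x∈H) ∷ ∈H y∈H P∈H
    ... | P , Q , P∈H , Q∈H , Q0≈1 , Qφ≋P = P , Q , P∈H , Q∈H , Q≠0 Q Q0≈1 , Qφ≋P
      where
      Q≠0 : ∀ Q → ⟦ Q ⟧ 0 ≈ 1# → Any (_# 0#) Q
      Q≠0 []      0≈1 = contradiction (#-congʳ (sym 0≈1) 1#0) (#-irrefl refl)
      Q≠0 (x ∷ Q) x≈1 = here (#-congʳ (sym x≈1) 1#0)

  -- Pochhammer symbols as products

  poch-cong : ∀ {x y} → x ≈ y → ∀ n → poch x n ≈ poch y n
  poch-cong x≈y zero    = refl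
  poch-cong x≈y (suc n) = *-cong (poch-cong x≈y n) (+-congʳ x≈y)

  poch-sucˡ : ∀ x n → poch x (suc n) ≈ x * poch (x + 1#) n
  poch-sucˡ x zero    = solve 1 (λ x → :1 :* (x :+ :0) := x :* :1) refl x
  poch-sucˡ x (suc n) = trans (*-congʳ (poch-sucˡ x n))
    (solve 3 (λ x P n → x :* P :* (x :+ (:1 :+ n)) := x :* (P :* (x :+ :1 :+ n))) refl _ _ _)

  product-descending : ∀ y m →
    product {m} (λ u → y + (m · 1# - toℕ u · 1#)) ≈ poch (y + 1#) m
  product-descending y zero    = refl
  product-descending y (suc m) = begin
    (y + (1# + m · 1# - 0#)) * product {m} (λ u → y + (1# + m · 1# - (1# + toℕ u · 1#)))
      ≈⟨ *-cong (solve 2 (λ y m → y :+ (:1 :+ m :- :0) := y :+ :1 :+ m) refl _ _)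
                (product-cong {m} λ u →
                  solve 3 (λ y m u → y :+ (:1 :+ m :- (:1 :+ u)) := y :+ (m :- u))
                        refl y (m · 1#) (toℕ u · 1#)) ⟩
    (y + 1# + m · 1#) * product {m} (λ u → y + (m · 1# - toℕ u · 1#))
      ≈⟨ *-congˡ (product-descending y m) ⟩
    (y + 1# + m · 1#) * poch (y + 1#) m
      ≈⟨ *-comm _ _ ⟩
    poch (y + 1#) m * (y + 1# + m · 1#) ∎

  product-ascending : ∀ y n →
    product {n} (λ u → y - toℕ u · 1#) ≈ (- 1#) ^ n * poch (- y) n
  product-ascending y zero    = sym (*-identityˡ 1#)
  product-ascending y (suc n) = begin
    (y - 0#) * product {n} (λ u → y - (1# + toℕ u · 1#))
      ≈⟨ *-congˡ (product-cong {n} λ u →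
           solve 2 (λ y u → y :- (:1 :+ u) := y :- :1 :- u) refl y (toℕ u · 1#)) ⟩
    (y - 0#) * product {n} (λ u → y - 1# - toℕ u · 1#)
      ≈⟨ *-congˡ (product-ascending (y - 1#) n) ⟩
    (y - 0#) * ((- 1#) ^ n * poch (- (y - 1#)) n)
      ≈⟨ *-congˡ (*-congˡ (poch-cong (solve 1 (λ y → :- (y :- :1) := :- y :+ :1) refl y) n)) ⟩
    (y - 0#) * ((- 1#) ^ n * poch (- y + 1#) n)
      ≈⟨ solve 3 (λ y s P → (y :- :0) :* (s :* P) := :- :1 :* s :* (:- y :* P)) refl _ _ _ ⟩
    - 1# * (- 1#) ^ n * (- y * poch (- y + 1#) n)
      ≈⟨ *-congˡ (poch-sucˡ (- y) n) ⟨
    - 1# * (- 1#) ^ n * poch (- y) (suc n) ∎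

  sign-square : ∀ n → (- 1#) ^ n * (- 1#) ^ n ≈ 1#
  sign-square zero    = *-identityˡ 1#
  sign-square (suc n) = trans
    (solve 1 (λ s → (:- :1 :* s) :* (:- :1 :* s) := s :* s) refl _) (sign-square n)

  -- If u - v and x - y agree, then u # v gives x # y.
  #-resp-difference : ∀ {u v x y} → u - v ≈ x - y → u # v → x # y
  #-resp-difference eq u#v with #⇒invertible u#v
  ... | w , wu≈1 , uw≈1 =
    invertible⇒# (w , trans (*-congˡ (sym eq)) wu≈1 , trans (*-congʳ (sym eq)) uw≈1)

  fromℤ-difference : ∀ m n → ∃ λ z → fromℤ z ≈ m · 1# - n · 1#
  fromℤ-difference m zero          = + m , sym (x-0≈x _)
  fromℤ-difference zero (suc n)    = -[1+ n ] , sym (+-identityˡ _)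
  fromℤ-difference (suc m) (suc n) with fromℤ-difference m n
  ... | z , eq = z , trans eq (solve 2 (λ m n → m :- n := :1 :+ m :- (:1 :+ n)) refl _ _)

  module _ (charZero : CharZero) where

    ℕ-apart : ∀ {m n} → m ≢ n → m · 1# # n · 1#
    ℕ-apart {zero}  {zero}  m≢n = contradiction ≡.refl m≢n
    ℕ-apart {zero}  {suc n} m≢n = #-sym (charZero n)
    ℕ-apart {suc m} {zero}  m≢n = charZero m
    ℕ-apart {suc m} {suc n} m≢n =
      #-resp-difference (solve 2 (λ m n → m :- n := :1 :+ m :- (:1 :+ n)) refl _ _)
                        (ℕ-apart (m≢n ∘ ≡.cong suc))

  module Nodes (charZero : CharZero) {r : ℕ} (a b : Fin r → Carrier)
               (distinct : DistinctModℤ b) where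
    open Hypergeometric charZero a b distinct

    -- The nodes 1 - b i + m and their Lagrange weights

    Index : Set
    Index = Fin r × ℕ

    -- The exponent of the m-th term of f i
    node : Index → Carrier
    node (i , m) = (1# - b i) + m · 1#

    _≟_ : (p q : Index) → Dec (p ≡ q)
    _≟_ = ≡-dec _≟ᶠ_ ℕ._≟_

    node-apart : ∀ {p q} → p ≢ q → node p # node q
    node-apart {i , m} {j , n} p≢q with i ≟ᶠ j
    ... | yes ≡.refl =
      #-resp-difference (solve 3 (λ m n b → m :- n := (:1 :- b :+ m) :- (:1 :- b :+ n)) refl _ _ _)
                        (ℕ-apart charZero (p≢q ∘ ≡.cong (i ,_)))
    ... | no i≢j with fromℤ-difference m n
    ... | z , eq = #-sym (#-resp-difference
      (trans (+-congˡ (-‿cong eq))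
             (solve 4 (λ b b′ m n → (b :- b′) :- (m :- n) := (:1 :- b′ :+ n) :- (:1 :- b :+ m))
                    refl _ _ _ _))
      (distinct i j i≢j z))

    difference : ∀ p q → Dec (p ≡ q) → Carrier
    difference p q (yes _) = 1#
    difference p q (no _)  = node p - node q

    -- node p - node q for p ≠ q, and 1 for p = q
    d : Index → Index → Carrier
    d p q = difference p q (p ≟ q)

    d-diagonal : ∀ p → d p p ≈ 1#
    d-diagonal p with p ≟ p
    ... | yes _   = refl
    ... | no  p≢p = contradiction ≡.refl p≢p

    d-off-diagonal : ∀ {p q} → p ≢ q → d p q ≈ node p - node q
    d-off-diagonal {p} {q} p≢q with p ≟ q
    ... | yes p≡q = contradiction p≡q p≢q
    ... | no  _   = refl

    open Lagrange node d d-diagonal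

    -- The nodes 1 - b i + m with m ≤ N
    grid : ℕ → List Index
    grid N = cartesianProduct (allFin r) (upTo (suc N))

    grid-separated : ∀ N → AllPairs Separated (grid N)
    grid-separated N = AllPairs.map
      (λ p≢q → node-apart p≢q , d-off-diagonal p≢q , d-off-diagonal (p≢q ∘ ≡.sym))
      (cartesianProduct⁺ (allFin⁺ r) (upTo⁺ (suc N)))

    -- The inverse of the factor j of coefficient i
    b-difference : ∀ i j → Dec (j ≡ i) → Carrier
    b-difference i j (yes _) = 1#
    b-difference i j (no _)  = b j - b i

    c-factor-inverse : ∀ i j (j≟i : Dec (j ≡ i)) → c-factor i j j≟i * b-difference i j j≟i ≈ 1#
    c-factor-inverse i j (yes _)  = *-identityˡ 1#
    c-factor-inverse i j (no j≢i) = trans (*-comm _ _) (inv-inverseʳ (distinct j i j≢i (+ 0)))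

    d-same-row : ∀ i j m → d (i , m) (j , m) ≈ b-difference i j (j ≟ᶠ i)
    d-same-row i j m with j ≟ᶠ i
    ... | yes ≡.refl = d-diagonal (i , m)
    ... | no  j≢i    = trans (d-off-diagonal (j≢i ∘ ≡.sym ∘ ≡.cong proj₁))
      (solve 3 (λ b b′ m → (:1 :- b :+ m) :- (:1 :- b′ :+ m) := b′ :- b) refl _ _ _)

    -- The products of Pochhammer symbols in the coefficients of f i and g i
    lowerF lowerG upperF upperG : Fin r → ℕ → Carrier
    lowerF i m = product λ j → poch (b j + 1# - b i) m
    lowerG i n = product λ j → poch (b i + 1# - b j) n
    upperF i m = product λ j → poch (a j + 1# - b i) m
    upperG i n = product λ j → poch (b i - a j) n

    -- (-1) ^ (r n)
    sign : ℕ → Carrier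
    sign n = product {r} λ _ → (- 1#) ^ n

    sign-inverse : ∀ n → sign n * sign n ≈ 1#
    sign-inverse n = begin
      sign n * sign n                            ≈⟨ product-* {r} _ _ ⟨
      product {r} (λ _ → (- 1#) ^ n * (- 1#) ^ n) ≈⟨ product-cong {r} (λ _ → sign-square n) ⟩
      product {r} (λ _ → 1#)                     ≈⟨ product-one r ⟩
      1#                                         ∎

    -- The product of the differences of the node (i , m) from all the others,
    -- N = m + n: those from the nodes (j , u) with u < m give lowerF, those with
    -- u = m give 1 / coefficient i, and those with u > m give lowerG up to sign.
    product-d : ∀ i m n → productOver (grid (m ℕ.+ n)) (d (i , m))
      ≈ lowerF i m * (product (λ j → b-difference i j (j ≟ᶠ i)) * (sign n * lowerG i n))
    product-d i m n = begin
      productOver (grid (m ℕ.+ n)) (d (i , m))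
        ≈⟨ productOver-grid r (suc (m ℕ.+ n)) (d (i , m)) ⟩
      product (λ j → product {suc (m ℕ.+ n)} λ u → d (i , m) (j , toℕ u))
        ≈⟨ product-cong column ⟩
      product (λ j → poch (b j + 1# - b i) m
                   * (b-difference i j (j ≟ᶠ i) * ((- 1#) ^ n * poch (b i + 1# - b j) n)))
        ≈⟨ product-* {r} _ _ ⟩
      lowerF i m * product (λ j → b-difference i j (j ≟ᶠ i) * ((- 1#) ^ n * poch (b i + 1# - b j) n))
        ≈⟨ *-congˡ (trans (product-* {r} _ _) (*-congˡ (product-* {r} _ _))) ⟩
      lowerF i m * (product (λ j → b-difference i j (j ≟ᶠ i)) * (sign n * lowerG i n)) ∎
      where
      column : ∀ j → product {suc (m ℕ.+ n)} (λ u → d (i , m) (j , toℕ u))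
        ≈ poch (b j + 1# - b i) m
          * (b-difference i j (j ≟ᶠ i) * ((- 1#) ^ n * poch (b i + 1# - b j) n))
      column j = trans (product-splitAt (λ u → d (i , m) (j , u)) m n)
                       (*-cong below (*-cong (d-same-row i j m) above))
        where
        below : product {m} (λ u → d (i , m) (j , toℕ u)) ≈ poch (b j + 1# - b i) m
        below = begin
          product {m} (λ u → d (i , m) (j , toℕ u))
            ≈⟨ product-cong {m} (λ u → trans
                 (d-off-diagonal (ℕ.>⇒≢ (toℕ<n u) ∘ ≡.cong proj₂))
                 (solve 4 (λ b b′ m u → (:1 :- b :+ m) :- (:1 :- b′ :+ u)
                                     := (b′ :- b) :+ (m :- u)) refl _ _ _ _)) ⟩
          product {m} (λ u → (b j - b i) + (m · 1# - toℕ u · 1#))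
            ≈⟨ product-descending (b j - b i) m ⟩
          poch (b j - b i + 1#) m
            ≈⟨ poch-cong (solve 2 (λ b b′ → b′ :- b :+ :1 := b′ :+ :1 :- b) refl _ _) m ⟩
          poch (b j + 1# - b i) m ∎
        above : product {n} (λ u → d (i , m) (j , suc (m ℕ.+ toℕ u)))
                ≈ (- 1#) ^ n * poch (b i + 1# - b j) n
        above = begin
          product {n} (λ u → d (i , m) (j , suc (m ℕ.+ toℕ u)))
            ≈⟨ product-cong {n} (λ u → trans
                 (d-off-diagonal (ℕ.m≢1+m+n m ∘ ≡.cong proj₂))
                 (trans (+-congˡ (-‿cong (+-congˡ (+-congˡ (×-homo-+ 1# m (toℕ u))))))
                 (solve 4 (λ b b′ m u → (:1 :- b :+ m) :- (:1 :- b′ :+ (:1 :+ (m :+ u)))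
                                     := (b′ :- b :- :1) :- u) refl _ _ _ _))) ⟩
          product {n} (λ u → (b j - b i - 1#) - toℕ u · 1#)
            ≈⟨ product-ascending (b j - b i - 1#) n ⟩
          (- 1#) ^ n * poch (- (b j - b i - 1#)) n
            ≈⟨ *-congˡ (poch-cong
                 (solve 2 (λ b b′ → :- (b′ :- b :- :1) := b :+ :1 :- b′) refl _ _) n) ⟩
          (- 1#) ^ n * poch (b i + 1# - b j) n ∎

    -- The numbers 1 + u - a j with u < N.  The values at a node of the monic
    -- polynomial with these roots are, up to sign, the numerators of the products
    -- of a coefficient of f i and one of g i that contribute to z^N.
    numeratorRoots : ℕ → List Carrier
    numeratorRoots N =
      map (λ { (j , u) → (1# + u · 1#) - a j }) (cartesianProduct (allFin r) (upTo N))

    monic-numeratorRoots : ∀ i m n →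
      monic (numeratorRoots (m ℕ.+ n)) (node (i , m)) ≈ upperF i m * (sign n * upperG i n)
    monic-numeratorRoots i m n = begin
      monic (numeratorRoots (m ℕ.+ n)) (node (i , m))
        ≈⟨ productOver-map _ (cartesianProduct (allFin r) (upTo (m ℕ.+ n))) ⟩
      productOver (cartesianProduct (allFin r) (upTo (m ℕ.+ n))) F
        ≈⟨ productOver-grid r (m ℕ.+ n) F ⟩
      product (λ j → product {m ℕ.+ n} λ u → F (j , toℕ u))
        ≈⟨ product-cong column ⟩
      product (λ j → poch (a j + 1# - b i) m * ((- 1#) ^ n * poch (b i - a j) n))
        ≈⟨ trans (product-* {r} _ _) (*-congˡ (product-* {r} _ _)) ⟩
      upperF i m * (sign n * upperG i n) ∎
      where
      F : Index → Carrier
      F (j , u) = node (i , m) - ((1# + u · 1#) - a j)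
      column : ∀ j → product {m ℕ.+ n} (λ u → F (j , toℕ u))
        ≈ poch (a j + 1# - b i) m * ((- 1#) ^ n * poch (b i - a j) n)
      column j = trans (product-split (λ u → F (j , u)) m n) (*-cong below above)
        where
        below : product {m} (λ u → F (j , toℕ u)) ≈ poch (a j + 1# - b i) m
        below = begin
          product {m} (λ u → F (j , toℕ u))
            ≈⟨ product-cong {m} (λ u →
                 solve 4 (λ b a m u → (:1 :- b :+ m) :- (:1 :+ u :- a)
                                     := (a :- b) :+ (m :- u)) refl _ _ _ _) ⟩
          product {m} (λ u → (a j - b i) + (m · 1# - toℕ u · 1#))
            ≈⟨ product-descending (a j - b i) m ⟩
          poch (a j - b i + 1#) m
            ≈⟨ poch-cong (solve 2 (λ b a → a :- b :+ :1 := a :+ :1 :- b) refl _ _) m ⟩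
          poch (a j + 1# - b i) m ∎
        above : product {n} (λ u → F (j , m ℕ.+ toℕ u)) ≈ (- 1#) ^ n * poch (b i - a j) n
        above = begin
          product {n} (λ u → F (j , m ℕ.+ toℕ u))
            ≈⟨ product-cong {n} (λ u →
                 trans (+-congˡ (-‿cong (+-congʳ (+-congˡ (×-homo-+ 1# m (toℕ u))))))
                 (solve 4 (λ b a m u → (:1 :- b :+ m) :- (:1 :+ (m :+ u) :- a)
                                     := (a :- b) :- u) refl _ _ _ _)) ⟩
          product {n} (λ u → (a j - b i) - toℕ u · 1#)
            ≈⟨ product-ascending (a j - b i) n ⟩
          (- 1#) ^ n * poch (- (a j - b i)) n
            ≈⟨ *-congˡ (poch-cong (solve 2 (λ b a → :- (a :- b) := b :- a) refl _ _) n) ⟩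
          (- 1#) ^ n * poch (b i - a j) n ∎

    -- The Lagrange weight of the node (i , m) in grid (m + n).  Its factor sign n
    -- is the one of product-d, and it cancels the one of monic-numeratorRoots.
    weightOf : Fin r → ℕ → ℕ → Carrier
    weightOf i m n = coefficient i * (inv (product#0 λ j → denominator#0 j i m)
                   * (sign n * inv (product#0 λ j → denominator#0 i j n)))

    weight : ℕ → Index → Carrier
    weight N (i , m) = weightOf i m (N ∸ m)

    weightOf-inverse : ∀ i m n →
      weightOf i m n * productOver (grid (m ℕ.+ n)) (d (i , m)) ≈ 1#
    weightOf-inverse i m n = begin
      cᵢ * (F⁻¹ * (s * G⁻¹)) * productOver (grid (m ℕ.+ n)) (d (i , m))
        ≈⟨ *-congˡ (product-d i m n) ⟩
      cᵢ * (F⁻¹ * (s * G⁻¹)) * (F * (B * (s * G)))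
        ≈⟨ solve 7 (λ c F⁻¹ s G⁻¹ F B G → c :* (F⁻¹ :* (s :* G⁻¹)) :* (F :* (B :* (s :* G)))
                := (c :* B) :* ((F :* F⁻¹) :* ((s :* s) :* (G :* G⁻¹)))) refl _ _ _ _ _ _ _ ⟩
      (cᵢ * B) * ((F * F⁻¹) * ((s * s) * (G * G⁻¹)))
        ≈⟨ *-cong cB≈1 (*-cong (inv-inverseʳ _) (*-cong (sign-inverse n) (inv-inverseʳ _))) ⟩
      1# * (1# * (1# * 1#))
        ≈⟨ solve 0 (:1 :* (:1 :* (:1 :* :1)) := :1) refl ⟩
      1# ∎
      where
      cᵢ = coefficient i
      F⁻¹ = inv (product#0 λ j → denominator#0 j i m)
      G⁻¹ = inv (product#0 λ j → denominator#0 i j n)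
      F = lowerF i m
      G = lowerG i n
      s = sign n
      B = product λ j → b-difference i j (j ≟ᶠ i)
      cB≈1 : cᵢ * B ≈ 1#
      cB≈1 = trans (sym (product-* {r} _ _))
            (trans (product-cong (λ j → c-factor-inverse i j (j ≟ᶠ i))) (product-one r))

    weight-isWeight : ∀ N → IsWeight (grid N) (weight N)
    weight-isWeight N = All.tabulate λ {p} p∈ → lemma p (m≤N p∈)
      where
      lemma : ∀ p → proj₂ p ≤ N → weight N p * productOver (grid N) (d p) ≈ 1#
      lemma (i , m) m≤N = ≡.subst
        (λ n → weightOf i m (N ∸ m) * productOver (grid n) (d (i , m)) ≈ 1#)
        (ℕ.m+[n∸m]≡n m≤N) (weightOf-inverse i m (N ∸ m))
      m≤N : ∀ {p} → p ∈ grid N → proj₂ p ≤ N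
      m≤N p∈ = ℕ.≤-pred (∈-upTo⁻ (proj₂ (∈-cartesianProduct⁻ (allFin r) (upTo (suc N)) p∈)))

    -- The coefficients of f i and g i in terms of weights
    f*g≈weightOf : ∀ i m n →
      coefficient i * (f i .series m * g i .series n)
      ≈ weightOf i m n * monic (numeratorRoots (m ℕ.+ n)) (node (i , m))
    f*g≈weightOf i m n = begin
      cᵢ * ((upperF i m * F⁻¹) * (upperG i n * G⁻¹))
        ≈⟨ *-identityˡ _ ⟨
      1# * (cᵢ * ((upperF i m * F⁻¹) * (upperG i n * G⁻¹)))
        ≈⟨ *-congʳ (sign-inverse n) ⟨
      s * s * (cᵢ * ((upperF i m * F⁻¹) * (upperG i n * G⁻¹)))
        ≈⟨ solve 6 (λ c F⁻¹ s G⁻¹ F G → s :* s :* (c :* ((F :* F⁻¹) :* (G :* G⁻¹)))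
              := c :* (F⁻¹ :* (s :* G⁻¹)) :* (F :* (s :* G))) refl _ _ _ _ _ _ ⟩
      weightOf i m n * (upperF i m * (s * upperG i n))
        ≈⟨ *-congˡ (monic-numeratorRoots i m n) ⟨
      weightOf i m n * monic (numeratorRoots (m ℕ.+ n)) (node (i , m)) ∎
      where
      cᵢ = coefficient i
      F⁻¹ = inv (product#0 λ j → denominator#0 j i m)
      G⁻¹ = inv (product#0 λ j → denominator#0 i j n)
      s = sign n

    length-grid : ∀ n → length (cartesianProduct (allFin r) (upTo n)) ≡ r ℕ.* n
    length-grid n = ≡.trans (length-product (allFin r))
      (≡.cong₂ ℕ._*_ (length-tabulate {n = r} id) (length-upTo n))
      where
      length-product : ∀ (l : List (Fin r)) →
        length (cartesianProduct l (upTo n)) ≡ length l ℕ.* length (upTo n)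
      length-product []      = ≡.refl
      length-product (i ∷ l) = ≡.trans (length-++ (map (i ,_) (upTo n)))
        (≡.cong₂ ℕ._+_ (length-map (i ,_) (upTo n)) (length-product l))

    -- Products of derivatives of solutions

    -- q(θ)(g i) without its factor z^(b i - 1), for q a function of the exponent
    gAt : (Carrier → Carrier) → Fin r → PowerSeries
    gAt q i n = q ((b i - 1#) + n · 1#) * g i .series n

    -- The sum of c_i θ^k (f_i) q(θ)(g_i)
    T : ℕ → (Carrier → Carrier) → PowerSeries
    T k q = ∑ λ i → coefficient i ∙ (θ^ k (f i) .series ⊛ gAt q i)

    ∑-cong : {φ ψ : Fin r → PowerSeries} → (∀ i → φ i ≋ ψ i) →
             ∑ (λ i → coefficient i ∙ φ i) ≋ ∑ (λ i → coefficient i ∙ ψ i)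
    ∑-cong φ≋ψ n = sum-cong-≋ λ i → *-congˡ {coefficient i} (φ≋ψ i n)

    T-cong : ∀ k {q q′ : Carrier → Carrier} → (∀ s → q s ≈ q′ s) → T k q ≋ T k q′
    T-cong k q≈q′ = ∑-cong λ i → ⊛-congʳ (θ^ k (f i) .series) λ n → *-congʳ (q≈q′ _)

    T-linear : ∀ k q x q′ → T k (λ s → q s + x * q′ s) ≋ T k q ⊕ x ∙ T k q′
    T-linear k q x q′ n = begin
      T k (λ s → q s + x * q′ s) n
        ≈⟨ ∑-cong (λ i m → trans (⊛-congʳ (F i) (gAt-linear i) m)
                                 (⊛-linearʳ (F i) (gAt q i) x (gAt q′ i) m)) n ⟩
      sum (λ i → coefficient i * ((F i ⊛ gAt q i) n + x * (F i ⊛ gAt q′ i) n))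
        ≈⟨ sum-cong-≋ (λ i → solve 4 (λ c y x z → c :* (y :+ x :* z) := c :* y :+ x :* (c :* z))
             refl (coefficient i) ((F i ⊛ gAt q i) n) x ((F i ⊛ gAt q′ i) n)) ⟩
      sum (λ i → coefficient i * (F i ⊛ gAt q i) n + x * (coefficient i * (F i ⊛ gAt q′ i) n))
        ≈⟨ sum-linear r _ (λ i → coefficient i * (F i ⊛ gAt q′ i) n) x ⟩
      T k q n + x * T k q′ n ∎
      where
      F : Fin r → PowerSeries
      F i = θ^ k (f i) .series
      gAt-linear : ∀ i → gAt (λ s → q s + x * q′ s) i ≋ gAt q i ⊕ x ∙ gAt q′ i
      gAt-linear i n = trans (distribʳ _ _ _) (+-congˡ (*-assoc _ _ _))

    θ^-monic : ∀ {s} l (F : z^ s ⟦z⟧) n →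
      θ^ l F .series n ≈ monic (replicate l 0#) (s + n · 1#) * F .series n
    θ^-monic zero    F n = sym (*-identityˡ _)
    θ^-monic (suc l) F n = trans
      (*-cong (sym (x-0≈x _)) (θ^-monic l F n)) (sym (*-assoc _ _ _))

    M≋T : ∀ k l → M k l ≋ T k (monic (replicate l 0#))
    M≋T k l = ∑-cong λ i → ⊛-congʳ (θ^ k (f i) .series) (θ^-monic l (g i))

    -- The coefficients of T k q as divided differences

    N≈m+n : ∀ {N} (m : Fin (suc N)) → toℕ m ℕ.+ (N ∸ toℕ m) ≡ N
    N≈m+n m = ℕ.m+[n∸m]≡n (ℕ.≤-pred (toℕ<n m))

    monic-reflect : ∀ ρ x t →
      monic ρ (x - t) ≈ (- 1#) ^ length ρ * monic (map (λ y → x - y) ρ) t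
    monic-reflect []      x t = sym (*-identityˡ 1#)
    monic-reflect (y ∷ ρ) x t = trans (*-congˡ (monic-reflect ρ x t))
      (solve 5 (λ x y t s P → (x :- t :- y) :* (s :* P) := (:- :1 :* s) :* ((t :- (x :- y)) :* P))
             refl _ _ _ _ _)

    -- The roots of t^k monic ρ (N - t) Y(t), where Y has the numeratorRoots N
    roots : ℕ → List Carrier → ℕ → List Carrier
    roots k ρ N = replicate k 0# ++ (map (λ y → N · 1# - y) ρ ++ numeratorRoots N)

    T-term : ∀ k ρ i m n →
      coefficient i * (θ^ k (f i) .series m * gAt (monic ρ) i n)
      ≈ (- 1#) ^ length ρ * (weightOf i m n * monic (roots k ρ (m ℕ.+ n)) (node (i , m)))
    T-term k ρ i m n = begin
      coefficient i * (θ^ k (f i) .series m * (monic ρ ((b i - 1#) + n · 1#) * g i .series n))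
        ≈⟨ *-congˡ (*-cong (θ^-monic k (f i) m) (*-congʳ reflect)) ⟩
      coefficient i * ((X * f i .series m) * ((s * Y) * g i .series n))
        ≈⟨ solve 6 (λ c X F s Y G → c :* ((X :* F) :* ((s :* Y) :* G))
                                 := (s :* (X :* Y)) :* (c :* (F :* G))) refl _ _ _ _ _ _ ⟩
      (s * (X * Y)) * (coefficient i * (f i .series m * g i .series n))
        ≈⟨ *-congˡ (f*g≈weightOf i m n) ⟩
      (s * (X * Y)) * (weightOf i m n * Z)
        ≈⟨ solve 5 (λ s X Y w Z → (s :* (X :* Y)) :* (w :* Z) := s :* (w :* (X :* (Y :* Z))))
                 refl _ _ _ _ _ ⟩
      s * (weightOf i m n * (X * (Y * Z)))
        ≈⟨ *-congˡ (*-congˡ (trans (monic-++ (replicate k 0#) _ x)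
                                   (*-congˡ (monic-++ (map (λ y → N - y) ρ) _ x)))) ⟨
      s * (weightOf i m n * monic (roots k ρ (m ℕ.+ n)) x) ∎
      where
      x = node (i , m)
      N = (m ℕ.+ n) · 1#
      s = (- 1#) ^ length ρ
      X = monic (replicate k 0#) x
      Y = monic (map (λ y → N - y) ρ) x
      Z = monic (numeratorRoots (m ℕ.+ n)) x
      reflect : monic ρ ((b i - 1#) + n · 1#) ≈ s * Y
      reflect = trans (monic-cong ρ (sym (trans (+-congʳ (×-homo-+ 1# m n))
        (solve 3 (λ b m n → m :+ n :- (:1 :- b :+ m) := b :- :1 :+ n) refl _ _ _))))
        (monic-reflect ρ N x)

    T-dividedDifference : ∀ k ρ N →
      T k (monic ρ) N
      ≈ (- 1#) ^ length ρ * sumOver (grid N) (λ p → weight N p * monic (roots k ρ N) (node p))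
    T-dividedDifference k ρ N = begin
      T k (monic ρ) N
        ≈⟨ sum-cong-≋ (λ i → trans
             (*-distribˡ-sum {suc N} (coefficient i) (λ m →
                θ^ k (f i) .series (toℕ m) * gAt (monic ρ) i (N ∸ toℕ m)))
             (trans (sum-cong-≋ {suc N} (term i))
                    (sym (*-distribˡ-sum {suc N} s (λ m → F (i , toℕ m)))))) ⟩
      sum (λ i → s * sum {suc N} (λ m → F (i , toℕ m)))
        ≈⟨ *-distribˡ-sum s (λ i → sum {suc N} (λ m → F (i , toℕ m))) ⟨
      s * sum (λ i → sum {suc N} (λ m → F (i , toℕ m)))
        ≈⟨ *-congˡ (sumOver-grid r (suc N) F) ⟨
      s * sumOver (grid N) F ∎
      where
      s = (- 1#) ^ length ρ
      F : Index → Carrier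
      F p = weight N p * monic (roots k ρ N) (node p)
      term : ∀ i (m : Fin (suc N)) →
        coefficient i * (θ^ k (f i) .series (toℕ m) * gAt (monic ρ) i (N ∸ toℕ m))
        ≈ s * F (i , toℕ m)
      term i m = ≡.subst
        (λ n → coefficient i * (θ^ k (f i) .series (toℕ m) * gAt (monic ρ) i (N ∸ toℕ m))
             ≈ s * (weightOf i (toℕ m) (N ∸ toℕ m) * monic (roots k ρ n) (node (i , toℕ m))))
        (N≈m+n m) (T-term k ρ i (toℕ m) (N ∸ toℕ m))

    -- There are r (N + 1) nodes and k + ∣ρ∣ + r N roots, so that the divided
    -- difference does not depend on N.
    T-low : ∀ k ρ j → suc (j ℕ.+ (k ℕ.+ length ρ)) ≡ r →
      ∀ N → T k (monic ρ) N ≈ (- 1#) ^ length ρ * atZero j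
    T-low k ρ j eq N = trans (T-dividedDifference k ρ N)
      (*-congˡ (dividedDifference (roots k ρ N) (grid N) (weight N) j
                 (grid-separated N) (weight-isWeight N) lengths))
      where
      length-roots : length (roots k ρ N) ≡ k ℕ.+ (length ρ ℕ.+ r ℕ.* N)
      length-roots = ≡.trans (length-++ (replicate k 0#))
        (≡.cong₂ ℕ._+_ (length-replicate k) (≡.trans (length-++ (map (λ y → N · 1# - y) ρ))
          (≡.cong₂ ℕ._+_ (length-map _ ρ) (≡.trans (length-map _ (cartesianProduct (allFin r) (upTo N)))
                                                   (length-grid N)))))
      count : r ℕ.* suc N ≡ suc (j ℕ.+ (k ℕ.+ (length ρ ℕ.+ r ℕ.* N)))
      count = ≡.trans (ℕ.*-suc r N) (≡.trans (≡.cong (ℕ._+ r ℕ.* N) (≡.sym eq))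
        (≡.cong suc (≡.trans (ℕ.+-assoc j _ _) (≡.cong (j ℕ.+_) (ℕ.+-assoc k _ _)))))
      lengths : length (grid N) ≡ suc (j ℕ.+ length (roots k ρ N))
      lengths = ≡.trans (length-grid (suc N))
        (≡.trans count (≡.cong (λ n → suc (j ℕ.+ n)) (≡.sym length-roots)))

    -- Differential equations

    ⊛-leibniz : ∀ {s t} (F : z^ s ⟦z⟧) (G : z^ t ⟦z⟧) → s + t ≈ 0# →
      (θ F .series ⊛ G .series) ⊕ (F .series ⊛ θ G .series) ≋ ϑ (F .series ⊛ G .series)
    ⊛-leibniz {s} {t} F G s+t≈0 N = begin
      (θ F .series ⊛ G .series) N + (F .series ⊛ θ G .series) N
        ≈⟨ ∑-distrib-+ {suc N} (λ m → θ F .series (toℕ m) * G .series (N ∸ toℕ m))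
                               (λ m → F .series (toℕ m) * θ G .series (N ∸ toℕ m)) ⟨
      sum {suc N} (λ m → θ F .series (toℕ m) * G .series (N ∸ toℕ m)
                       + F .series (toℕ m) * θ G .series (N ∸ toℕ m))
        ≈⟨ sum-cong-≋ {suc N} term ⟩
      sum {suc N} (λ m → N · 1# * (F .series (toℕ m) * G .series (N ∸ toℕ m)))
        ≈⟨ *-distribˡ-sum {suc N} (N · 1#) (λ m → F .series (toℕ m) * G .series (N ∸ toℕ m)) ⟨
      N · 1# * (F .series ⊛ G .series) N ∎
      where
      term : ∀ (m : Fin (suc N)) →
        θ F .series (toℕ m) * G .series (N ∸ toℕ m) + F .series (toℕ m) * θ G .series (N ∸ toℕ m)
        ≈ N · 1# * (F .series (toℕ m) * G .series (N ∸ toℕ m))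
      term m = begin
        (s + m′) * Fm * Gn + Fm * ((t + n′) * Gn)
          ≈⟨ solve 6 (λ s t m n F G → (s :+ m) :* F :* G :+ F :* ((t :+ n) :* G)
                                   := (s :+ t :+ (m :+ n)) :* (F :* G)) refl s t m′ n′ Fm Gn ⟩
        (s + t + (m′ + n′)) * (Fm * Gn)
          ≈⟨ *-congʳ (trans (+-congʳ s+t≈0) (+-identityˡ _)) ⟩
        (m′ + n′) * (Fm * Gn)
          ≈⟨ *-congʳ (trans (sym (×-homo-+ 1# (toℕ m) (N ∸ toℕ m)))
                            (reflexive (≡.cong (_· 1#) (N≈m+n m)))) ⟩
        N · 1# * (Fm * Gn) ∎
        where
        m′ = toℕ m · 1#
        n′ = (N ∸ toℕ m) · 1#
        Fm = F .series (toℕ m)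
        Gn = G .series (N ∸ toℕ m)

    T-leibniz : ∀ k q → T (suc k) q ⊕ T k (λ s → (s - 0#) * q s) ≋ ϑ (T k q)
    T-leibniz k q N = begin
      T (suc k) q N + T k (λ s → (s - 0#) * q s) N
        ≈⟨ +-congˡ (∑-cong (λ i → ⊛-congʳ (θ^ k (f i) .series) (gAt-θ i)) N) ⟩
      T (suc k) q N + sum (λ i → coefficient i * (θ^ k (f i) .series ⊛ θ (G i) .series) N)
        ≈⟨ ∑-distrib-+ {r} _ _ ⟨
      sum (λ i → coefficient i * (θ^ (suc k) (f i) .series ⊛ G i .series) N
               + coefficient i * (θ^ k (f i) .series ⊛ θ (G i) .series) N)
        ≈⟨ sum-cong-≋ (λ i → trans (sym (distribˡ _ _ _))
             (*-congˡ (⊛-leibniz (θ^ k (f i)) (G i) (exponents-cancel i) N))) ⟩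
      sum (λ i → coefficient i * (N · 1# * (θ^ k (f i) .series ⊛ G i .series) N))
        ≈⟨ sum-cong-≋ (λ i → solve 3 (λ c n x → c :* (n :* x) := n :* (c :* x)) refl
             (coefficient i) (N · 1#) ((θ^ k (f i) .series ⊛ G i .series) N)) ⟩
      sum (λ i → N · 1# * (coefficient i * (θ^ k (f i) .series ⊛ G i .series) N))
        ≈⟨ *-distribˡ-sum (N · 1#) (λ i → coefficient i * (θ^ k (f i) .series ⊛ G i .series) N) ⟨
      ϑ (T k q) N ∎
      where
      G : ∀ i → z^ (b i - 1#) ⟦z⟧
      G i = z^· (gAt q i)
      gAt-θ : ∀ i → gAt (λ s → (s - 0#) * q s) i ≋ θ (G i) .series
      gAt-θ i n = trans (*-congʳ (*-congʳ (x-0≈x _))) (*-assoc _ _ _)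

    -- The dual hypergeometric equation is monic β (θ) g = z monic α (θ) g.
    α β : List Carrier
    α = tabulate λ j → a j - 1#
    β = tabulate λ j → b j - 1#

    g-recurrence : ∀ i n →
      monic β ((b i - 1#) + suc n · 1#) * g i .series (suc n)
      ≈ monic α ((b i - 1#) + n · 1#) * g i .series n
    g-recurrence i n = begin
      monic β ((b i - 1#) + suc n · 1#) * (upperG i (suc n) * L⁻¹)
        ≈⟨ *-cong monic-β (*-congʳ (product-* (λ j → poch (b i - a j) n) _)) ⟩
      E * (U * A * L⁻¹)
        ≈⟨ solve 4 (λ E U A L → E :* (U :* A :* L) := A :* (U :* (E :* L))) refl _ _ _ _ ⟩
      A * (U * (E * L⁻¹))
        ≈⟨ *-cong monic-α (*-congˡ EL⁻¹) ⟩
      monic α ((b i - 1#) + n · 1#) * (U * L₀⁻¹) ∎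
      where
      U = upperG i n
      A = product λ j → b i - a j + n · 1#
      E = product λ j → b i + 1# - b j + n · 1#
      L₀ = lowerG i n
      L₀⁻¹ = inv (product#0 λ j → denominator#0 i j n)
      L⁻¹ = inv (product#0 λ j → denominator#0 i j (suc n))
      monic-β : monic β ((b i - 1#) + suc n · 1#) ≈ E
      monic-β = trans (productOver-tabulate {n = r} (λ j → b j - 1#)) (product-cong λ j →
        solve 3 (λ b b′ n → b :- :1 :+ (:1 :+ n) :- (b′ :- :1) := b :+ :1 :- b′ :+ n)
              refl (b i) (b j) (n · 1#))
      monic-α : A ≈ monic α ((b i - 1#) + n · 1#)
      monic-α = sym (trans (productOver-tabulate {n = r} (λ j → a j - 1#)) (product-cong λ j →
        solve 3 (λ b a n → b :- :1 :+ n :- (a :- :1) := b :- a :+ n) refl (b i) (a j) (n · 1#)))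
      EL⁻¹ : E * L⁻¹ ≈ L₀⁻¹
      EL⁻¹ = begin
        E * L⁻¹                    ≈⟨ *-identityˡ _ ⟨
        1# * (E * L⁻¹)             ≈⟨ *-congʳ (inv-inverseʳ (product#0 λ j → denominator#0 i j n)) ⟨
        L₀ * L₀⁻¹ * (E * L⁻¹)
          ≈⟨ solve 4 (λ L L₀ E L⁻¹ → L :* L₀ :* (E :* L⁻¹) := L₀ :* ((L :* E) :* L⁻¹)) refl _ _ _ _ ⟩
        L₀⁻¹ * (L₀ * E * L⁻¹)
          ≈⟨ *-congˡ (*-congʳ (product-* (λ j → poch (b i + 1# - b j) n) _)) ⟨
        L₀⁻¹ * (lowerG i (suc n) * L⁻¹)
          ≈⟨ *-congˡ (inv-inverseʳ (product#0 λ j → denominator#0 i j (suc n))) ⟩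
        L₀⁻¹ * 1#                  ≈⟨ *-identityʳ _ ⟩
        L₀⁻¹                       ∎

    -- The dual hypergeometric equation, with q(θ) z = z q⁺(θ) for q⁺(s) = q(s + 1)
    gAt-equation : ∀ i (q q⁺ : Carrier → Carrier) → (∀ s t → t ≈ s + 1# → q t ≈ q⁺ s) →
      gAt (λ s → q s * monic β s) i ≋ shift (gAt (λ s → q⁺ s * monic α s) i)
    gAt-equation i q q⁺ q-shift zero = begin
      q s * monic β s * g i .series 0     ≈⟨ *-congʳ (*-congˡ monic≈0) ⟩
      q s * 0# * g i .series 0            ≈⟨ *-congʳ (zeroʳ _) ⟩
      0# * g i .series 0                  ≈⟨ zeroˡ _ ⟩
      0#                                  ∎
      where
      s = (b i - 1#) + 0#
      monic≈0 : monic β s ≈ 0#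
      monic≈0 = trans (productOver-tabulate {n = r} (λ j → b j - 1#))
        (product-zero _ i (solve 1 (λ b → b :- :1 :+ :0 :- (b :- :1) := :0) refl (b i)))
    gAt-equation i q q⁺ q-shift (suc n) = begin
      q t * monic β t * g i .series (suc n)      ≈⟨ *-assoc _ _ _ ⟩
      q t * (monic β t * g i .series (suc n))
        ≈⟨ *-cong (q-shift s t (solve 2 (λ b n → b :+ (:1 :+ n) := b :+ n :+ :1) refl _ _))
                  (g-recurrence i n) ⟩
      q⁺ s * (monic α s * g i .series n)         ≈⟨ *-assoc _ _ _ ⟨
      q⁺ s * monic α s * g i .series n           ∎
      where
      s = (b i - 1#) + n · 1#
      t = (b i - 1#) + suc n · 1#

    T-equation : ∀ k (q q⁺ : Carrier → Carrier) → (∀ s t → t ≈ s + 1# → q t ≈ q⁺ s) →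
      T k (λ s → q s * monic β s) ≋ shift (T k (λ s → q⁺ s * monic α s))
    T-equation k q q⁺ q-shift n = trans
      (∑-cong (λ i m → trans (⊛-congʳ (F i) (gAt-equation i q q⁺ q-shift) m)
                             (⊛-shift (F i) (G i) m)) n)
      (∑-shift n)
      where
      F G : Fin r → PowerSeries
      F i = θ^ k (f i) .series
      G = gAt (λ s → q⁺ s * monic α s)
      ∑-shift : ∑ (λ i → coefficient i ∙ shift (F i ⊛ G i))
                ≋ shift (∑ λ i → coefficient i ∙ (F i ⊛ G i))
      ∑-shift zero    = trans (sum-cong-≋ (λ i → zeroʳ (coefficient i))) (sum-replicate-zero r)
      ∑-shift (suc n) = refl

    -- Rationality

    open RationalSeries [ a , b ]′

    infixl 6 _⊖_
    _⊖_ : PowerSeries → PowerSeries → PowerSeries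
    φ ⊖ ψ = φ ⊕ (- 1#) ∙ ψ

    -- Modulo lower degrees, T k depends only on the degree of a monic
    -- polynomial.  The roots are exchanged one at a time.
    T-exchange : ∀ k q ρ ρ′ → All H ρ → All H ρ′ → length ρ ≡ length ρ′ →
      (∀ π → All H π → suc (length π) ≡ length ρ → Rational (T k λ s → q s * monic π s)) →
      Rational (T k (λ s → q s * monic ρ s) ⊖ T k (λ s → q s * monic ρ′ s))
    T-exchange k q [] [] _ _ _ _ = Rational-constant zero∈H λ n →
      trans (+-congˡ (-1*x≈-x _)) (-‿inverseʳ _)
    T-exchange k q (σ ∷ ρ) (σ′ ∷ ρ′) (σ∈H ∷ ρ∈H) (σ′∈H ∷ ρ′∈H) eq lower =
      Rational-resp combine
        (Rational-⊕ (Rational-∙ (add σ′∈H (neg σ∈H)) (lower ρ ρ∈H ≡.refl))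
                    (T-exchange k q′ ρ ρ′ ρ∈H ρ′∈H (ℕ.suc-injective eq) λ π π∈H |π| →
                       Rational-resp (T-cong k λ s → sym (*-assoc (q s) (s - σ′) (monic π s)))
                                     (lower (σ′ ∷ π) (σ′∈H ∷ π∈H) (≡.cong suc |π|))))
      where
      q′ : Carrier → Carrier
      q′ s = q s * (s - σ′)
      old mid new rest : PowerSeries
      old  = T k λ s → q s * monic (σ ∷ ρ) s
      new  = T k λ s → q s * monic (σ′ ∷ ρ′) s
      mid  = T k λ s → q′ s * monic ρ s
      rest = T k λ s → q s * monic ρ s
      old≋ : old ≋ mid ⊕ (σ′ - σ) ∙ rest
      old≋ n = trans
        (T-cong k (λ s → solve 5 (λ q s σ σ′ P → q :* ((s :- σ) :* P)
                             := q :* (s :- σ′) :* P :+ (σ′ :- σ) :* (q :* P))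
                           refl (q s) s σ σ′ (monic ρ s)) n)
        (T-linear k (λ s → q′ s * monic ρ s) (σ′ - σ) (λ s → q s * monic ρ s) n)
      combine : (σ′ - σ) ∙ rest ⊕ (mid ⊖ T k (λ s → q′ s * monic ρ′ s)) ≋ old ⊖ new
      combine n = begin
        (σ′ - σ) * rest n + (mid n + - 1# * T k (λ s → q′ s * monic ρ′ s) n)
          ≈⟨ +-congˡ (+-congˡ (*-congˡ (T-cong k (λ s → *-assoc (q s) (s - σ′) (monic ρ′ s)) n))) ⟩
        (σ′ - σ) * rest n + (mid n + - 1# * new n)
          ≈⟨ solve 3 (λ x y z → x :+ (y :+ z) := (y :+ x) :+ z) refl _ _ _ ⟩
        (mid n + (σ′ - σ) * rest n) + - 1# * new n
          ≈⟨ +-congʳ (old≋ n) ⟨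
        old n + - 1# * new n ∎

    sign∈H : ∀ n → H ((- 1#) ^ n)
    sign∈H zero    = one
    sign∈H (suc n) = mul (neg one) (sign∈H n)

    atZero∈H : ∀ j → H (atZero j)
    atZero∈H zero    = one
    atZero∈H (suc j) = zero∈H

    -- Below degree r, T-low gives constant coefficients.  From degree r on, the
    -- dual equation gives T 0 β′ = z T 0 α′ for two monic polynomials β′ and α′ of
    -- the same degree, and T 0 α′ - T 0 β′ is rational by induction; hence so is
    -- (1 - z) T 0 α′.
    T₀-rational : 0 < r → ∀ d ρ → All H ρ → length ρ ≡ d → Rational (T 0 (monic ρ))
    T₀-rational 0<r d ρ ρ∈H |ρ| with suc d ℕ.≤? r
    ... | yes d<r = Rational-constant
      (mul (sign∈H (length ρ)) (atZero∈H (r ∸ suc d)))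
      (T-low 0 ρ (r ∸ suc d) (≡.trans (≡.cong (λ n → suc (r ∸ suc d ℕ.+ n)) |ρ|)
        (≡.trans (≡.sym (ℕ.+-suc (r ∸ suc d) d)) (ℕ.m∸n+n≡m d<r))))
    T₀-rational 0<r zero    ρ ρ∈H |ρ| | no d≮r = contradiction 0<r d≮r
    T₀-rational 0<r (suc d) ρ ρ∈H |ρ| | no d≮r =
      Rational-resp
        (λ n → solve 2 (λ x y → (x :+ :- :1 :* y) :+ y := x) refl
                     (T 0 (monic ρ) n) (T 0 (monic α′) n))
        (Rational-⊕ (exchange ρ α′ ρ∈H α′∈H |ρ| |α′|) T-α′)
      where
      e = suc d ∸ r
      r+e≡ : e ℕ.+ r ≡ suc d
      r+e≡ = ℕ.m∸n+n≡m (ℕ.≤-pred (ℕ.≰⇒> d≮r))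
      α′ β′ : List Carrier
      α′ = replicate e 0# ++ α
      β′ = replicate e 1# ++ β
      |α′| : length α′ ≡ suc d
      |α′| = ≡.trans (length-++ (replicate e 0#))
        (≡.trans (≡.cong₂ ℕ._+_ (length-replicate e) (length-tabulate {n = r} _)) r+e≡)
      |β′| : length β′ ≡ suc d
      |β′| = ≡.trans (length-++ (replicate e 1#))
        (≡.trans (≡.cong₂ ℕ._+_ (length-replicate e) (length-tabulate {n = r} _)) r+e≡)
      α′∈H : All H α′
      α′∈H = ++⁺ (replicate⁺ e zero∈H) (tabulate⁺ {n = r} λ j → add (gen (inj₁ j)) (neg one))
      β′∈H : All H β′
      β′∈H = ++⁺ (replicate⁺ e one) (tabulate⁺ {n = r} λ j → add (gen (inj₂ j)) (neg one))
      exchange : ∀ π π′ → All H π → All H π′ → length π ≡ suc d → length π′ ≡ suc d →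
                 Rational (T 0 (monic π) ⊖ T 0 (monic π′))
      exchange π π′ π∈H π′∈H |π| |π′| = Rational-resp
        (λ n → +-cong (T-cong 0 (λ s → *-identityˡ (monic π s)) n)
                      (*-congˡ (T-cong 0 (λ s → *-identityˡ (monic π′ s)) n)))
        (T-exchange 0 (λ _ → 1#) π π′ π∈H π′∈H (≡.trans |π| (≡.sym |π′|)) λ ω ω∈H |ω| →
           Rational-resp (T-cong 0 λ s → sym (*-identityˡ (monic ω s)))
             (T₀-rational 0<r d ω ω∈H (ℕ.suc-injective (≡.trans |ω| |π|))))
      -- (s + 1 - 1)^e = s^e, which is why β′ has roots 1 where α′ has roots 0
      shift-zeros : ∀ e s t → t ≈ s + 1# →
                    monic (replicate e 1#) t ≈ monic (replicate e 0#) s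
      shift-zeros zero    s t t≈s+1 = refl
      shift-zeros (suc e) s t t≈s+1 = *-cong
        (trans (+-congʳ t≈s+1) (solve 1 (λ s → s :+ :1 :- :1 := s :- :0) refl s))
        (shift-zeros e s t t≈s+1)
      β′≋zα′ : T 0 (monic β′) ≋ shift (T 0 (monic α′))
      β′≋zα′ n = trans (T-cong 0 (monic-++ (replicate e 1#) β) n)
        (trans (T-equation 0 (monic (replicate e 1#)) (monic (replicate e 0#)) (shift-zeros e) n)
               (shift-cong (T-cong 0 λ s → sym (monic-++ (replicate e 0#) α s)) n))
      T-α′ : Rational (T 0 (monic α′))
      T-α′ = divide (Rational-resp
        (λ n → +-congˡ (trans (-1*x≈-x _) (-‿cong (β′≋zα′ n))))
        (exchange α′ β′ α′∈H β′∈H |α′| |β′|))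

    T-rational : 0 < r → ∀ k ρ → All H ρ → Rational (T k (monic ρ))
    T-rational 0<r zero    ρ ρ∈H = T₀-rational 0<r (length ρ) ρ ρ∈H ≡.refl
    T-rational 0<r (suc k) ρ ρ∈H = Rational-resp
      (λ n → trans (+-congʳ (sym (T-leibniz k (monic ρ) n)))
        (solve 2 (λ x y → (x :+ y) :+ :- :1 :* y := x) refl
               (T (suc k) (monic ρ) n) (T k (monic (0# ∷ ρ)) n)))
      (Rational-⊕ (Rational-ϑ (T-rational 0<r k ρ ρ∈H))
                  (Rational-∙ (neg one) (T-rational 0<r k (0# ∷ ρ) (zero∈H ∷ ρ∈H))))

    M-rational : 0 < r → ∀ k l → M k l ∈ H ⟨z⟩
    M-rational 0<r k l = Rational⇒∈⟨z⟩ (Rational-resp (λ n → sym (M≋T k l n))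
      (T-rational 0<r k (replicate l 0#) (replicate⁺ l zero∈H)))

    M-low : ∀ k l j → suc (j ℕ.+ (k ℕ.+ l)) ≡ r → ∀ N → M k l N ≈ (- 1#) ^ l * atZero j
    M-low k l j eq N = begin
      M k l N                                              ≈⟨ M≋T k l N ⟩
      T k (monic (replicate l 0#)) N
        ≈⟨ T-low k (replicate l 0#) j
             (≡.trans (≡.cong (λ n → suc (j ℕ.+ (k ℕ.+ n))) (length-replicate l)) eq) N ⟩
      (- 1#) ^ length (replicate l 0#) * atZero j
        ≈⟨ *-congʳ (reflexive (≡.cong ((- 1#) ^_) (length-replicate l))) ⟩
      (- 1#) ^ l * atZero j                                ∎

    constant⇒expansion : ∀ {φ x} → (∀ n → φ n ≈ x) → φ IsExpansionOf (x ∷ []) / (1# ∷ - 1# ∷ [])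
    constant⇒expansion {φ} {x} φ≈x = here 1#0 , λ n → trans (⊛-congˡ φ denominator n)
      (trans (Δ-⊛ ⟦ 1# ∷ [] ⟧ φ n)
      (trans (Δ-cong (⟦1⟧-⊛ φ) n) (numerator n)))
      where
      denominator : ⟦ 1# ∷ - 1# ∷ [] ⟧ ≋ Δ ⟦ 1# ∷ [] ⟧
      denominator zero          = sym (x-0≈x 1#)
      denominator (suc zero)    = sym (+-identityˡ _)
      denominator (suc (suc n)) = sym (-‿inverseʳ 0#)
      numerator : Δ φ ≋ ⟦ x ∷ [] ⟧
      numerator zero    = trans (x-0≈x _) (φ≈x 0)
      numerator (suc n) = trans (+-cong (φ≈x (suc n)) (-‿cong (φ≈x n))) (-‿inverseʳ x)

theorem1p1 :
    ∀ {c ℓ₁ ℓ₂} (K : HeytingField c ℓ₁ ℓ₂) →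
    let open HeytingField K
        open Field K in
    (charZero : CharZero) →
    (r : ℕ) → 2 ≤ r →
    (a b : Fin r → Carrier) →
    (∀ i → suc (toℕ i) ≡ r → b i ≈ 1#) →
    (distinct : DistinctModℤ b) →
    let open Hypergeometric charZero a b distinct in
    ∀ k l → k < r → l < r →
      (M k l ∈ H ⟨z⟩) ×
      (k ℕ.+ l ≤ r ∸ 2 → M k l ≋ 𝟎) ×
      -- The sign is (-1)^l: the constant term of M k l is the sum over i of
      -- c_i (1 - b_i)^k (b_i - 1)^l, which equals (-1)^l when k + l = r - 1.
      (k ℕ.+ l ≡ r ∸ 1 →
        M k l IsExpansionOf ((- 1#) ^ l ∷ []) / (1# ∷ - 1# ∷ []))
theorem1p1 K charZero (suc (suc r)) (ℕ.s≤s (ℕ.s≤s _)) a b _ distinct k l _ _ =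
    M-rational (ℕ.s≤s ℕ.z≤n) k l
  , (λ k+l≤r N → trans (M-low k l (suc (r ∸ (k ℕ.+ l))) (≡.cong (λ n → suc (suc n)) (ℕ.m∸n+n≡m k+l≤r)) N)
                       (zeroʳ _))
  , (λ k+l≡1+r → constant⇒expansion λ N → trans (M-low k l 0 (≡.cong suc k+l≡1+r) N) (*-identityʳ _))
  where
  open HeytingField K using (trans; zeroʳ; *-identityʳ)
  open FieldTools K
  open Nodes charZero a b distinct
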